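{- Consider the 2-stage women-arrival stable matching problem (2-A-SMP). The following online algorithm Opt-2-Stage runs in polynomial time and always outputs an optimal solution: (1) at stage 1, knowing only $U$, $W_1$ and the preferences between $U$ and $W_1$, compute the men-optimal stable matching $M_1^*$ of the instance $(U,W_1)$; (2) at stage 2, compute a maximum-weight stable matching $M_2^*$ of the instance $(U,W_2)$, where a pair $(u,w)$ has weight $1$ if $(u,w)\in M_1^*$ and weight $0$ otherwise. That is, $(M_1^*,M_2^*)\in\Delta_1\times\Delta_2$ and $|M_1^*\setminus M_2^*|\le |M_1\setminus M_2|$ for every $(M_1,M_2)\in\Delta_1\times\Delta_2$.
   Context: 2-A-SMP: given a finite set $U$ of men and finite sets of women $W_1\subseteq W_2$, each man having a strict total order over $W_2$ and each woman a strict total order over $U$, compute matchings $(M_1,M_2)$ with $M_1$ stable for $(U,W_1)$ and $M_2$ stable for $(U,W_2)$ (preferences restricted accordingly) minimizing $|M_1\setminus M_2|$. $\Delta_1$, $\Delta_2$ denote the sets of stable matchings of $(U,W_1)$ and $(U,W_2)$. A matching is a set of pairs $(u,w)$ with each person in at most one pair. A blocking pair of $M$ is a pair $(u,w)\notin M$ with ($u$ unmatched or preferring $w$ to his partner) and ($w$ unmatched or preferring $u$ to her partner); a matching is stable if it has no blocking pair. The men-optimal stable matching is the stable matching in which every man gets his most preferred partner among all partners he has in some stable matching (it exists and is computed by the men-proposing Gale–Shapley algorithm). A maximum-weight stable matching is a stable matching maximizing the total weight of its pairs. -}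

module Defs where

open import Algebra.Properties.CommutativeMonoid.Sum using (sum)
open import Data.Bool.Base using (if_then_else_)
open import Data.Fin.Base using (Fin; toℕ; fromℕ<)
open import Data.Fin.Subset using (Subset; _∈_; _∉_; _∩_; _─_; ∣_∣; ⊤; ⊥)
open import Data.Fin.Subset.Properties using (_∈?_)
open import Data.List.Base as List using (List; []; _∷_; allFin; filter)
open import Data.Nat.Base using (ℕ; zero; suc; _+_; _*_; _∸_; _^_; _≤_; _<_; _≮_)
open import Data.Nat.Properties using (_<?_; _≟_; +-0-commutativeMonoid)
open import Data.Product.Base using (_×_; ∃-syntax)
open import Data.Sum.Base using (_⊎_)
open import Data.Vec.Base using (tabulate)
open import Level using (0ℓ)
open import Relation.Binary.Core using (Rel)
open import Relation.Binary.PropositionalEquality.Core using (_≡_)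
open import Relation.Binary.Structures using (IsStrictTotalOrder)
open import Relation.Nullary.Decidable.Core using (does; yes; no)
open import Relation.Nullary.Negation.Core using (¬_)

------------------------------------------------------------------------
-- Stable matchings

-- U = Fin m and W₂ = Fin n.  `ManPrefers u w w′` means that u strictly
-- prefers w to w′, and similarly for women.

record Preferences (m n : ℕ) : Set₁ where
  field
    ManPrefers   : Fin m → Rel (Fin n) 0ℓ
    WomanPrefers : Fin n → Rel (Fin m) 0ℓ
    manOrder     : ∀ u → IsStrictTotalOrder _≡_ (ManPrefers u)
    womanOrder   : ∀ w → IsStrictTotalOrder _≡_ (WomanPrefers w)

-- A set of pairs is given by its rows: (u , w) belongs to M iff w ∈ M u.

PairSet : ℕ → ℕ → Set
PairSet m n = Fin m → Subset n

∅ : ∀ {m n} → PairSet m n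
∅ u = ⊥

infixl 5 _∖_

_∖_ : ∀ {m n} → PairSet m n → PairSet m n → PairSet m n
(M ∖ M′) u = M u ─ M′ u

card : ∀ {m n} → PairSet m n → ℕ
card M = sum +-0-commutativeMonoid (λ u → ∣ M u ∣)

indicator : ∀ {m n} → PairSet m n → Fin m → Fin n → ℕ
indicator M u w = if does (w ∈? M u) then 1 else 0

totalWeight : ∀ {m n} → (Fin m → Fin n → ℕ) → PairSet m n → ℕ
totalWeight weight M =
  sum +-0-commutativeMonoid λ u →
  sum +-0-commutativeMonoid λ w → if does (w ∈? M u) then weight u w else 0

record IsMatching {m n} (W : Subset n) (M : PairSet m n) : Set where
  field
    within       : ∀ {u w} → w ∈ M u → w ∈ W
    man-unique   : ∀ {u w w′} → w ∈ M u → w′ ∈ M u → w ≡ w′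
    woman-unique : ∀ {u u′ w} → w ∈ M u → w ∈ M u′ → u ≡ u′

module _ {m n : ℕ} (P : Preferences m n) where
  open Preferences P

  -- The instance (U , W): all notions below quantify over women of W
  -- only, so they depend on P only through its restriction to U and W.

  record Blocking (W : Subset n) (M : PairSet m n) (u : Fin m) (w : Fin n) : Set where
    field
      present     : w ∈ W
      not-matched : w ∉ M u
      man-wants   : (∀ w′ → w′ ∉ M u) ⊎ (∃[ w′ ] w′ ∈ M u × ManPrefers u w w′)
      woman-wants : (∀ u′ → w ∉ M u′) ⊎ (∃[ u′ ] w ∈ M u′ × WomanPrefers w u u′)

  record IsStable (W : Subset n) (M : PairSet m n) : Set where
    field
      isMatching : IsMatching W M
      unblocked  : ∀ u w → ¬ Blocking W M u w

  StablePartner : Subset n → Fin m → Fin n → Set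
  StablePartner W u w = ∃[ M ] IsStable W M × w ∈ M u

  record IsMenOptimal (W : Subset n) (M : PairSet m n) : Set where
    field
      isStable : IsStable W M
      best     : ∀ u w → StablePartner W u w →
                 ∃[ w′ ] w′ ∈ M u × (w′ ≡ w ⊎ ManPrefers u w′ w)

  record IsMaxWeightStable (W : Subset n) (weight : Fin m → Fin n → ℕ)
                           (M : PairSet m n) : Set where
    field
      isStable : IsStable W M
      maximal  : ∀ M′ → IsStable W M′ → totalWeight weight M′ ≤ totalWeight weight M

  -- (M₁ , M₂) is a possible outcome of Opt-2-Stage.

  record Opt2Stage (W₁ : Subset n) (M₁ M₂ : PairSet m n) : Set where
    field
      stage₁ : IsMenOptimal W₁ M₁
      stage₂ : IsMaxWeightStable ⊤ (indicator M₁) M₂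

  record IsOptimal (W₁ : Subset n) (M₁ M₂ : PairSet m n) : Set where
    field
      stable₁ : IsStable W₁ M₁
      stable₂ : IsStable ⊤ M₂
      minimal : ∀ M₁′ M₂′ → IsStable W₁ M₁′ → IsStable ⊤ M₂′ →
                card (M₁ ∖ M₂) ≤ card (M₁′ ∖ M₂′)

------------------------------------------------------------------------
-- Model of computation: while programs on a random access machine

-- The memory consists of two-dimensional arrays of natural numbers:
-- `s a i j` is the content of cell (i , j) of the array named a.  The
-- only arithmetic is + and ∸.  Sums at most double the largest number in
-- memory, so with unit costs the bit lengths grow at most linearly with
-- time and polynomial time here agrees with polynomial time on Turing
-- machines.  (With unit-cost multiplication it would not.)

Store : Set
Store = ℕ → ℕ → ℕ → ℕ

infix  9 _⟪_,_⟫
infixl 6 _⊕_ _⊖_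

data Expr : Set where
  con     : ℕ → Expr
  _⟪_,_⟫  : ℕ → Expr → Expr → Expr
  _⊕_ _⊖_ : Expr → Expr → Expr

⟦_⟧ : Expr → Store → ℕ
⟦ con c ⟧       s = c
⟦ a ⟪ e , f ⟫ ⟧ s = s a (⟦ e ⟧ s) (⟦ f ⟧ s)
⟦ e ⊕ f ⟧       s = ⟦ e ⟧ s + ⟦ f ⟧ s
⟦ e ⊖ f ⟧       s = ⟦ e ⟧ s ∸ ⟦ f ⟧ s

exprTime : Expr → ℕ
exprTime (con c)       = 1
exprTime (a ⟪ e , f ⟫) = suc (exprTime e + exprTime f)
exprTime (e ⊕ f)       = suc (exprTime e + exprTime f)
exprTime (e ⊖ f)       = suc (exprTime e + exprTime f)

infix  5 _⟪_,_⟫≔_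
infixr 4 _⨾_

data Cmd : Set where
  skip     : Cmd
  _⟪_,_⟫≔_ : ℕ → Expr → Expr → Expr → Cmd
  _⨾_      : Cmd → Cmd → Cmd
  if<      : Expr → Expr → Cmd → Cmd → Cmd
  while<   : Expr → Expr → Cmd → Cmd

update : ℕ → ℕ → ℕ → ℕ → Store → Store
update a i j v s a′ i′ j′ =
  if does (a ≟ a′) then (if does (i ≟ i′) then (if does (j ≟ j′) then v
    else s a′ i′ j′) else s a′ i′ j′) else s a′ i′ j′

-- ⟨ c , s ⟩⇓⟨ s′ , t ⟩: started in memory s, the program c halts after t
-- steps in memory s′.

infix 3 ⟨_,_⟩⇓⟨_,_⟩

data ⟨_,_⟩⇓⟨_,_⟩ : Cmd → Store → Store → ℕ → Set where

  ⇓skip : ∀ {s} → ⟨ skip , s ⟩⇓⟨ s , 1 ⟩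

  ⇓assign : ∀ {s a e f g} →
    ⟨ a ⟪ e , f ⟫≔ g , s ⟩⇓⟨ update a (⟦ e ⟧ s) (⟦ f ⟧ s) (⟦ g ⟧ s) s ,
                            suc (exprTime e + exprTime f + exprTime g) ⟩

  ⇓seq : ∀ {s s′ s″ c d t t′} →
    ⟨ c , s ⟩⇓⟨ s′ , t ⟩ →
    ⟨ d , s′ ⟩⇓⟨ s″ , t′ ⟩ →
    ⟨ c ⨾ d , s ⟩⇓⟨ s″ , suc (t + t′) ⟩

  ⇓if-true : ∀ {s s′ e f c d t} →
    ⟦ e ⟧ s < ⟦ f ⟧ s →
    ⟨ c , s ⟩⇓⟨ s′ , t ⟩ →
    ⟨ if< e f c d , s ⟩⇓⟨ s′ , suc (exprTime e + exprTime f + t) ⟩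

  ⇓if-false : ∀ {s s′ e f c d t} →
    ⟦ e ⟧ s ≮ ⟦ f ⟧ s →
    ⟨ d , s ⟩⇓⟨ s′ , t ⟩ →
    ⟨ if< e f c d , s ⟩⇓⟨ s′ , suc (exprTime e + exprTime f + t) ⟩

  ⇓while-true : ∀ {s s′ s″ e f c t t′} →
    ⟦ e ⟧ s < ⟦ f ⟧ s →
    ⟨ c , s ⟩⇓⟨ s′ , t ⟩ →
    ⟨ while< e f c , s′ ⟩⇓⟨ s″ , t′ ⟩ →
    ⟨ while< e f c , s ⟩⇓⟨ s″ , suc (exprTime e + exprTime f + t + t′) ⟩

  ⇓while-false : ∀ {s e f c} →
    ⟦ e ⟧ s ≮ ⟦ f ⟧ s →
    ⟨ while< e f c , s ⟩⇓⟨ s , suc (exprTime e + exprTime f) ⟩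

------------------------------------------------------------------------
-- Input and output of the two stages

-- Cells outside the index range of a table hold 0.

table : ∀ {a b} → (Fin a → Fin b → ℕ) → ℕ → ℕ → ℕ
table {a} {b} f i j with i <? a | j <? b
... | yes i<a | yes j<b = f (fromℕ< i<a) (fromℕ< j<b)
... | _       | _       = 0

column : List ℕ → ℕ → ℕ → ℕ
column (x ∷ xs) zero    zero = x
column (x ∷ xs) (suc i) zero = column xs i zero
column _        _       _    = 0

women : ∀ {n} → Subset n → List ℕ
women W = List.map toℕ (filter (_∈? W) (allFin _))

module _ {m n : ℕ} (P : Preferences m n) (W : Subset n) where
  open Preferences P

  -- Ranks in the preferences restricted to (U , W), the most preferred
  -- person having rank 0.

  manRank : Fin m → Fin n → ℕ
  manRank u w = if does (w ∈? W) then ∣ W ∩ tabulate (λ w′ → does (w′ ≻? w)) ∣ else 0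
    where open IsStrictTotalOrder (manOrder u) renaming (_<?_ to _≻?_)

  womanRank : Fin n → Fin m → ℕ
  womanRank w u = if does (w ∈? W) then ∣ tabulate (λ u′ → does (u′ ≻? u)) ∣ else 0
    where open IsStrictTotalOrder (womanOrder w) renaming (_<?_ to _≻?_)

  -- Everything that is known about (U , W), together with a set K of
  -- distinguished pairs (the pairs of weight 1):
  --   array 0: ∣U∣ and ∣W∣ in cells (0 , 0) and (1 , 0)
  --   array 1: the names of the women of W, in cells (0 , 0), (1 , 0), …
  --   array 2: the rank of woman w for man u, in cell (u , w)
  --   array 3: the rank of man u for woman w, in cell (w , u)
  --   array 4: the characteristic function of K
  -- All other cells hold 0.  Men and women are named by their numbers.

  input : PairSet m n → Store
  input K 0 = column (m ∷ ∣ W ∣ ∷ [])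
  input K 1 = column (women W)
  input K 2 = table manRank
  input K 3 = table womanRank
  input K 4 = table (indicator K)
  input K _ = λ _ _ → 0

-- Bounding the time by a polynomial in the number of persons is at least
-- as strong as bounding it by one in the length of the input.

size : ∀ (m : ℕ) {n} → Subset n → ℕ
size m W = m + ∣ W ∣

-- The result is the characteristic function of M, in array 5.

Outputs : ∀ {m n} → Store → PairSet m n → Set
Outputs s M = ∀ i j → s 5 i j ≡ table (indicator M) i j

-- `Computes c s M b`: started in memory s, the program c halts within b
-- steps and outputs M.

Computes : ∀ {m n} → Cmd → Store → PairSet m n → ℕ → Set
Computes c s M b = ∃[ s′ ] ∃[ t ] ⟨ c , s ⟩⇓⟨ s′ , t ⟩ × Outputs s′ M × t ≤ b

poly : ℕ → ℕ → ℕ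
poly k x = k * x ^ k + k

-- The programs c₁ and c₂ implement the two stages of Opt-2-Stage on the
-- given instance.  The first one sees the instance (U , W₁) only; the
-- second one sees (U , W₂) and the output M₁ of the first one.

Implements : ∀ {m n} → Cmd → Cmd → (k : ℕ) → Preferences m n → Subset n → Set
Implements {m} {n} c₁ c₂ k P W₁ =
  ∃[ M₁ ] ∃[ M₂ ]
      Opt2Stage P W₁ M₁ M₂
    × Computes c₁ (input P W₁ ∅) M₁ (poly k (size m W₁))
    × Computes c₂ (input P ⊤ M₁) M₂ (poly k (size m (⊤ {n})))

{-# OPTIONS --safe #-}
module Submission where

-- Let M₁ be stable for (U , W₁) and M₂ stable for (U , W₂).  If every man
-- takes the better of his two partners, the result M₁ ∨ M₂ is a stable
-- matching of (U , W₂): the men who strictly prefer M₁ are permuted by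
-- "the M₂-partner of the M₁-partner", so no woman is left behind.
--
-- Optimality.  Let M₁* be men-optimal.  A pair of M₁* lost in M₁* ∨ M₂
-- belongs to a man whose M₂-partner is better than his best stable partner
-- in W₁, hence better than his partner in any stable M₁, and he does have a
-- partner in M₁; so M₁ loses his pair as well.
--
-- Second stage.  As M₂ ∩ M₁* ⊆ M₁* ∨ M₂, only stable matchings in which no
-- man is worse off than in M₁* matter.  Among these the women-optimal one
-- contains every common pair of any of them with M₁*.  It is found by
-- deferred acceptance with the women proposing, where each man also holds a
-- permanent proposal of his M₁*-partner.  The same program with the men
-- proposing and no permanent proposals does the first stage.

open import Algebra.Properties.CommutativeMonoid.Sum using (sum; sum-cong-≗; ∑-distrib-+)
open import Data.Bool.Base using (true; false; not; T; if_then_else_)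
open import Data.Empty using (⊥-elim) renaming (⊥ to Empty)
open import Data.Fin.Base using (Fin; zero; suc; toℕ; fromℕ<; punchOut)
open import Data.Fin.Properties using (any?; all?; injective⇒≤; punchOut-injective; toℕ-injective; toℕ<n; fromℕ<-toℕ; toℕ-fromℕ<; fromℕ<-injective; suc-injective) renaming (_≟_ to _≟ᶠ_)
open import Data.Fin.Subset using (Subset; inside; outside; _∈_; _∉_; _∩_; _─_; ∣_∣; ⊤; ⁅_⁆; Nonempty)
open import Data.Fin.Subset.Properties
open import Data.List.Base as List using (filter)
open import Data.Nat.Base hiding (compare)
open import Data.Nat.Properties hiding (suc-injective)
open import Data.Product.Base using (_×_; _,_; ∃-syntax; proj₁; proj₂)
open import Data.Sum.Base as Sum using (_⊎_; inj₁; inj₂)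
open import Data.Unit.Base using () renaming (⊤ to Unit)
open import Data.Vec.Base using ([]; _∷_; here; there; tabulate)
open import Data.Vec.Properties using ([]=⇒lookup; lookup⇒[]=; lookup∘tabulate)
open import Function.Base using (_∘_; id)
open import Level using (0ℓ)
open import Relation.Binary.Core using (Rel)
open import Relation.Binary.Definitions using (tri<; tri≈; tri>)
open import Relation.Binary.PropositionalEquality
open import Relation.Binary.Structures using (IsStrictTotalOrder)
open import Relation.Nullary.Decidable using (Dec; does; yes; no; dec-true; dec-false; _×-dec_; _→-dec_)
open import Relation.Nullary.Negation using (¬_; contradiction)
open import Defs

-- Programs with bounded loops

-- `for c b p` runs p with cell (0 , 0) of array c counting from 0 up to
-- (excluding) the content of cell (b , 0) of array 0.

data Prog : Set where
  nop   : Prog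
  put   : ℕ → Expr → Expr → Expr → Prog
  _▷_   : Prog → Prog → Prog
  when< : Expr → Expr → Prog → Prog → Prog
  for   : (c b : ℕ) → Prog → Prog

infixr 4 _▷_

cell : ℕ → Expr
cell c = c ⟪ con 0 , con 0 ⟫

compile : Prog → Cmd
compile nop             = skip
compile (put a e f g)   = a ⟪ e , f ⟫≔ g
compile (p ▷ q)         = compile p ⨾ compile q
compile (when< e f p q) = if< e f (compile p) (compile q)
compile (for c b p)     =
  (c ⟪ con 0 , con 0 ⟫≔ con 0) ⨾
  while< (cell c) (0 ⟪ con b , con 0 ⟫)
    (compile p ⨾ (c ⟪ con 0 , con 0 ⟫≔ cell c ⊕ con 1))

bump : ℕ → Store → Store
bump c s = update c 0 0 (s c 0 0 + 1) s

iter : ℕ → (Store → Store) → Store → Store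
iter zero    f s = s
iter (suc k) f s = iter k f (f s)

run : Prog → Store → Store
run nop             s = s
run (put a e f g)   s = update a (⟦ e ⟧ s) (⟦ f ⟧ s) (⟦ g ⟧ s) s
run (p ▷ q)         s = run q (run p s)
run (when< e f p q) s = if does (⟦ e ⟧ s <? ⟦ f ⟧ s) then run p s else run q s
run (for c b p)     s = iter (s 0 b 0) (bump c ∘ run p) (update c 0 0 0 s)

-- A syntactic guarantee that array `a` keeps its contents. The boolean test makes it compute to
-- unit types on a concrete program, so that its proofs can be filled in with `_`.
Fresh : ℕ → Prog → Set
Fresh a nop              = Unit
Fresh a (put a′ e f g)   = T (not (a′ ≡ᵇ a))
Fresh a (p ▷ q)          = Fresh a p × Fresh a q
Fresh a (when< e f p q)  = Fresh a p × Fresh a q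
Fresh a (for c b p)      = T (not (c ≡ᵇ a)) × Fresh a p

-- No loop body writes its own counter, and array 0, which holds the loop bounds, is never written.
-- So the number of iterations of a loop is fixed on entry.
WF : Prog → Set
WF nop              = Unit
WF (put a e f g)    = T (not (a ≡ᵇ 0))
WF (p ▷ q)          = WF p × WF q
WF (when< e f p q)  = WF p × WF q
WF (for c b p)      = T (not (c ≡ᵇ 0)) × Fresh c p × WF p

update-other : ∀ {a} a′ i j v s x y → T (not (a′ ≡ᵇ a)) → update a′ i j v s a x y ≡ s a x y
update-other {a} a′ i j v s x y d with a′ ≡ᵇ a
... | false = refl

update-same : ∀ a i j v s → update a i j v s a i j ≡ v
update-same a i j v s
  rewrite dec-true (a ≟ a) refl | dec-true (i ≟ i) refl | dec-true (j ≟ j) refl = refl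

run-fresh : ∀ {a} p s x y → Fresh a p → run p s a x y ≡ s a x y
iter-fresh : ∀ {a} c p k s x y → T (not (c ≡ᵇ a)) → Fresh a p →
             iter k (bump c ∘ run p) s a x y ≡ s a x y

run-fresh nop             s x y _ = refl
run-fresh (put a e f g)   s x y d = update-other a (⟦ e ⟧ s) (⟦ f ⟧ s) (⟦ g ⟧ s) s x y d
run-fresh (p ▷ q)         s x y (h , k) = trans (run-fresh q _ x y k) (run-fresh p s x y h)
run-fresh (when< e f p q) s x y (h , k) with does (⟦ e ⟧ s <? ⟦ f ⟧ s)
... | true  = run-fresh p s x y h
... | false = run-fresh q s x y k
run-fresh (for c b p)     s x y (d , h) =
  trans (iter-fresh c p (s 0 b 0) _ x y d h) (update-other c 0 0 0 s x y d)

iter-fresh c p zero    s x y d h = refl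
iter-fresh c p (suc k) s x y d h =
  trans (iter-fresh c p k _ x y d h)
    (trans (update-other c 0 0 _ (run p s) x y d) (run-fresh p s x y h))

WF⇒fresh₀ : ∀ p → WF p → Fresh 0 p
WF⇒fresh₀ nop             _ = _
WF⇒fresh₀ (put a e f g)   h = h
WF⇒fresh₀ (p ▷ q)         (h , k) = WF⇒fresh₀ p h , WF⇒fresh₀ q k
WF⇒fresh₀ (when< e f p q) (h , k) = WF⇒fresh₀ p h , WF⇒fresh₀ q k
WF⇒fresh₀ (for c b p)     (d , _ , h) = d , WF⇒fresh₀ p h

-- `N` bounds the number of iterations of every loop. `12` pays for resetting the counter, the
-- sequencing and the last, failing test; `16` pays for one successful test, the sequencing and the
-- increment.
time : Prog → ℕ → ℕ
time nop             N = 1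
time (put a e f g)   N = suc (exprTime e + exprTime f + exprTime g)
time (p ▷ q)         N = suc (time p N + time q N)
time (when< e f p q) N = suc (exprTime e + exprTime f + (time p N + time q N))
time (for c b p)     N = 12 + N * (16 + time p N)

Bounded : ℕ → Store → Set
Bounded N s = ∀ b → s 0 b 0 ≤ N

run-bounded : ∀ {N} p s → WF p → Bounded N s → Bounded N (run p s)
run-bounded p s h B b = ≤-trans (≤-reflexive (run-fresh p s b 0 (WF⇒fresh₀ p h))) (B b)

infix 3 _⊢_↓_

_⊢_↓_ : Prog → Store → ℕ → Set
p ⊢ s ↓ N = ∃[ t ] ⟨ compile p , s ⟩⇓⟨ run p s , t ⟩ × t ≤ time p N

count-down : ∀ c b p k s → WF (for c b p) → s c 0 0 + suc k ≡ s 0 b 0 →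
             bump c (run p s) c 0 0 + k ≡ bump c (run p s) 0 b 0
count-down c b p k s (c≢0 , fr , wf) eq = begin
  bump c (run p s) c 0 0 + k ≡⟨ cong (_+ k) (update-same c 0 0 _ (run p s)) ⟩
  run p s c 0 0 + 1 + k      ≡⟨ cong (λ x → x + 1 + k) (run-fresh p s 0 0 fr) ⟩
  s c 0 0 + 1 + k            ≡⟨ +-assoc (s c 0 0) 1 k ⟩
  s c 0 0 + suc k            ≡⟨ eq ⟩
  s 0 b 0                    ≡⟨ run-fresh p s b 0 (WF⇒fresh₀ p wf) ⟨
  run p s 0 b 0              ≡⟨ update-other c 0 0 _ (run p s) b 0 c≢0 ⟨
  bump c (run p s) 0 b 0     ∎
  where open ≡-Reasoning

iteration-time : ∀ {t t′ T} k → t ≤ T → t′ ≤ 7 + k * (16 + T) →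
                 7 + suc (t + 8) + t′ ≤ 7 + suc k * (16 + T)
iteration-time {t} {t′} {T} k t≤ t′≤ = begin
  7 + suc (t + 8) + t′         ≡⟨ cong (λ x → 7 + suc x + t′) (+-comm t 8) ⟩
  16 + t + t′                  ≤⟨ +-mono-≤ (+-monoʳ-≤ 16 t≤) t′≤ ⟩
  16 + T + (7 + k * (16 + T))  ≡⟨ +-assoc (16 + T) 7 _ ⟨
  16 + T + 7 + k * (16 + T)    ≡⟨ cong (_+ k * (16 + T)) (+-comm (16 + T) 7) ⟩
  7 + (16 + T) + k * (16 + T)  ≡⟨ +-assoc 7 (16 + T) _ ⟩
  7 + suc k * (16 + T)         ∎
  where open ≤-Reasoning

compile-correct : ∀ N p s → WF p → Bounded N s → p ⊢ s ↓ N

-- Induction on the number `k` of iterations still to come, which the memory determines as loop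
-- bound minus counter.
while-correct : ∀ N c b p k s → WF (for c b p) → Bounded N s → s c 0 0 + k ≡ s 0 b 0 →
  ∃[ t ] ⟨ while< (cell c) (0 ⟪ con b , con 0 ⟫)
             (compile p ⨾ (c ⟪ con 0 , con 0 ⟫≔ cell c ⊕ con 1)) , s ⟩⇓⟨
           iter k (bump c ∘ run p) s , t ⟩ × t ≤ 7 + k * (16 + time p N)

compile-correct N nop           s h B = 1 , ⇓skip , ≤-refl
compile-correct N (put a e f g) s h B = _ , ⇓assign , ≤-refl
compile-correct N (p ▷ q)       s (h , k) B
  with t , d , t≤ ← compile-correct N p s h B
  with t′ , d′ , t′≤ ← compile-correct N q (run p s) k (run-bounded p s h B) =
  _ , ⇓seq d d′ , s≤s (+-mono-≤ t≤ t′≤)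
compile-correct N (when< e f p q) s (h , k) B with ⟦ e ⟧ s <? ⟦ f ⟧ s
... | yes e<f rewrite dec-true (⟦ e ⟧ s <? ⟦ f ⟧ s) e<f
  with t , d , t≤ ← compile-correct N p s h B =
  _ , ⇓if-true e<f d ,
  s≤s (+-monoʳ-≤ (exprTime e + exprTime f) (≤-trans t≤ (m≤m+n _ _)))
... | no e≮f rewrite dec-false (⟦ e ⟧ s <? ⟦ f ⟧ s) e≮f
  with t , d , t≤ ← compile-correct N q s k B =
  _ , ⇓if-false e≮f d ,
  s≤s (+-monoʳ-≤ (exprTime e + exprTime f) (≤-trans t≤ (m≤n+m _ (time p N))))
compile-correct N (for c b p) s h@(c≢0 , _) B
  with t , d , t≤ ← while-correct N c b p (s 0 b 0) (update c 0 0 0 s) h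
         (λ b′ → ≤-trans (≤-reflexive (update-other c 0 0 0 s b′ 0 c≢0)) (B b′))
         (trans (cong (_+ s 0 b 0) (update-same c 0 0 0 s)) (sym (update-other c 0 0 0 s b 0 c≢0))) =
  _ , ⇓seq ⇓assign d ,
  ≤-trans (s≤s (+-monoʳ-≤ 4 t≤)) (+-monoʳ-≤ 12 (*-monoˡ-≤ (16 + time p N) (B b)))

while-correct N c b p zero s h B eq =
  _ , ⇓while-false (<-irrefl (trans (sym (+-identityʳ _)) eq)) , ≤-refl
while-correct N c b p (suc k) s h@(c≢0 , fr , wf) B eq
  with t , d , t≤ ← compile-correct N p s wf B
  with t′ , d′ , t′≤ ← while-correct N c b p k (bump c (run p s)) h
         (λ b′ → ≤-trans (≤-reflexive (update-other c 0 0 _ (run p s) b′ 0 c≢0))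
                         (run-bounded p s wf B b′))
         (count-down c b p k s h eq) =
  _ , ⇓while-true (subst (s c 0 0 <_) eq (m<m+n _ z<s)) (⇓seq d ⇓assign) d′ ,
  iteration-time k t≤ t′≤

-- Polynomial bounds on the running time

cost depth : Prog → ℕ
cost nop             = 1
cost (put a e f g)   = suc (exprTime e + exprTime f + exprTime g)
cost (p ▷ q)         = suc (cost p + cost q)
cost (when< e f p q) = suc (exprTime e + exprTime f + (cost p + cost q))
cost (for c b p)     = 16 + cost p

-- Exponents are added along a sequence and across branches: a cruder degree than the maximum, but
-- still independent of `N`.
depth nop             = 0
depth (put a e f g)   = 0
depth (p ▷ q)         = depth p + depth q
depth (when< e f p q) = depth p + depth q
depth (for c b p)     = suc (depth p)

private
  1≤S^ : ∀ N d → 1 ≤ suc N ^ d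
  1≤S^ N d = m^n>0 (suc N) d

  ≤*S^ : ∀ c N d → c ≤ c * suc N ^ d
  ≤*S^ c N d = ≤-trans (≤-reflexive (sym (*-identityʳ c))) (*-monoʳ-≤ c (1≤S^ N d))

  two : ∀ {t t′ c c′} N d d′ → t ≤ c * suc N ^ d → t′ ≤ c′ * suc N ^ d′ →
        ∀ κ → κ + (t + t′) ≤ (κ + (c + c′)) * suc N ^ (d + d′)
  two {t} {t′} {c} {c′} N d d′ h h′ κ = begin
    κ + (t + t′)                      ≤⟨ +-mono-≤ (≤*S^ κ N (d + d′)) (+-mono-≤
         (≤-trans h (*-monoʳ-≤ c (^-monoʳ-≤ (suc N) (m≤m+n d d′))))
         (≤-trans h′ (*-monoʳ-≤ c′ (^-monoʳ-≤ (suc N) (m≤n+m d′ d))))) ⟩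
    κ * S + (c * S + c′ * S)          ≡⟨ cong (κ * S +_) (sym (*-distribʳ-+ S c c′)) ⟩
    κ * S + (c + c′) * S              ≡⟨ sym (*-distribʳ-+ S κ (c + c′)) ⟩
    (κ + (c + c′)) * S                ∎
    where
    open ≤-Reasoning
    S = suc N ^ (d + d′)

time≤ : ∀ p N → time p N ≤ cost p * suc N ^ depth p
time≤ nop             N = ≤-refl
time≤ (put a e f g)   N = ≤-reflexive (sym (*-identityʳ _))
time≤ (p ▷ q)         N = two {c = cost p} N (depth p) (depth q) (time≤ p N) (time≤ q N) 1
time≤ (when< e f p q) N =
  two {c = cost p} N (depth p) (depth q) (time≤ p N) (time≤ q N) (suc (exprTime e + exprTime f))
time≤ (for c b p)     N = begin
  -- Entering and leaving the loop is charged as one further iteration, which turns the factor `N`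
  -- into `suc N`.
  12 + N * (16 + time p N)   ≤⟨ +-mono-≤ (≤-trans (m≤m+n 12 4) (≤*S^ 16 N d)) (*-monoʳ-≤ N
                                  (+-mono-≤ (≤*S^ 16 N d) (time≤ p N))) ⟩
  16 * S + N * (16 * S + C * S)    ≤⟨ +-monoˡ-≤ _ (*-monoˡ-≤ S (m≤m+n 16 C)) ⟩
  (16 + C) * S + N * (16 * S + C * S) ≡⟨ cong (λ x → (16 + C) * S + N * x) (sym (*-distribʳ-+ S 16 C)) ⟩
  suc N * ((16 + C) * S)     ≡⟨ sym (*-assoc (suc N) (16 + C) S) ⟩
  suc N * (16 + C) * S       ≡⟨ cong (_* S) (*-comm (suc N) (16 + C)) ⟩
  (16 + C) * suc N * S       ≡⟨ *-assoc (16 + C) (suc N) S ⟩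
  (16 + C) * (suc N * S)     ∎
  where
  open ≤-Reasoning
  d = depth p
  C = cost p
  S = suc N ^ d

[1+n]^d≤2^d*n^d : ∀ n .{{_ : NonZero n}} d → suc n ^ d ≤ 2 ^ d * n ^ d
[1+n]^d≤2^d*n^d n           zero    = ≤-refl
[1+n]^d≤2^d*n^d n@(suc n-1) (suc d) = begin
  suc n * suc n ^ d           ≤⟨ *-mono-≤ 1+n≤2n ([1+n]^d≤2^d*n^d n d) ⟩
  (2 * n) * (2 ^ d * n ^ d)   ≡⟨ [m*n]*[o*p]≡[m*o]*[n*p] 2 n (2 ^ d) (n ^ d) ⟩
  (2 * 2 ^ d) * (n * n ^ d)   ∎
  where
  open ≤-Reasoning
  1+n≤2n : suc n ≤ 2 * n
  1+n≤2n = +-mono-≤ {1} {n} (s≤s z≤n) (≤-reflexive (sym (+-identityʳ n)))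

-- For `N` positive, `suc N` is at most `2 * N`, whence the factor `2 ^ d`. For `N` zero the
-- additive `k` in `poly` takes over.
poly-bound : ∀ {t} c d k N → t ≤ c * suc N ^ d → c * 2 ^ d ≤ k → d ≤ k → t ≤ poly k N
poly-bound {t} c d k zero h ck dk = begin
  t                ≤⟨ h ⟩
  c * 1 ^ d        ≤⟨ *-monoʳ-≤ c (^-monoˡ-≤ d (s≤s z≤n)) ⟩
  c * 2 ^ d        ≤⟨ ck ⟩
  k                ≤⟨ m≤n+m k _ ⟩
  k * 0 ^ k + k    ∎
  where open ≤-Reasoning
poly-bound {t} c d k N@(suc _) h ck dk = begin
  t                      ≤⟨ h ⟩
  c * suc N ^ d          ≤⟨ *-monoʳ-≤ c ([1+n]^d≤2^d*n^d N d) ⟩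
  c * (2 ^ d * N ^ d)    ≡⟨ *-assoc c _ _ ⟨
  c * 2 ^ d * N ^ d      ≤⟨ *-mono-≤ ck (^-monoʳ-≤ N dk) ⟩
  k * N ^ k              ≤⟨ m≤m+n _ k ⟩
  k * N ^ k + k          ∎
  where open ≤-Reasoning

-- The rule of loop invariants, with `I` indexed by the number of completed iterations. The step may
-- also use that every array the loop does not write still has its contents from before the loop.
for-induction : ∀ {ℓ} c b p s N (I : ℕ → Store → Set ℓ) → WF (for c b p) → s 0 b 0 ≡ N →
  I 0 (update c 0 0 0 s) →
  (∀ (x : Fin N) s′ → s′ c 0 0 ≡ toℕ x →
    (∀ a i j → Fresh a (for c b p) → s′ a i j ≡ s a i j) →
    I (toℕ x) s′ → I (suc (toℕ x)) (bump c (run p s′))) →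
  I N (run (for c b p) s)
for-induction c b p s N I (c≢0 , fr , wf) refl base step =
  go N 0 (update c 0 0 0 s) refl (update-same c 0 0 0 s)
     (λ a x y (d , _) → update-other c 0 0 0 s x y d) base
  where
  go : ∀ k i s′ → i + k ≡ N → s′ c 0 0 ≡ i →
       (∀ a x y → Fresh a (for c b p) → s′ a x y ≡ s a x y) →
       I i s′ → I N (iter k (bump c ∘ run p) s′)
  go zero    i s′ eq _  _  h = subst (λ x → I x s′) (trans (sym (+-identityʳ i)) eq) h
  go (suc k) i s′ eq ct fm h =
    go k (suc i) (bump c (run p s′)) (trans (sym (+-suc i k)) eq)
      (begin
        bump c (run p s′) c 0 0 ≡⟨ update-same c 0 0 _ (run p s′) ⟩
        run p s′ c 0 0 + 1      ≡⟨ cong (_+ 1) (trans (run-fresh p s′ 0 0 fr) ct) ⟩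
        i + 1                   ≡⟨ +-comm i 1 ⟩
        suc i                   ∎)
      (λ a x y d → trans (update-other c 0 0 _ (run p s′) x y (proj₁ d))
                     (trans (run-fresh p s′ x y (proj₂ d)) (fm a x y d)))
      (subst (λ x → I (suc x) _) x≡i
        (step (fromℕ< i<N) s′ (trans ct (sym x≡i)) fm (subst (λ x → I x s′) (sym x≡i) h)))
    where
    open ≡-Reasoning
    i<N : i < N
    i<N = subst (i <_) eq (m<m+n i z<s)
    x≡i : toℕ (fromℕ< i<N) ≡ i
    x≡i = toℕ-fromℕ< i<N

-- Counting

-- If `y` were missed, punching it out of the codomain would leave an injection into a smaller
-- finite set.
injective⇒onto : ∀ {n} {f : Fin n → Fin n} → (∀ {x y} → f x ≡ f y → x ≡ y) →
                 ∀ y → ∃[ x ] f x ≡ y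
injective⇒onto {suc n} {f} inj y with any? (λ x → f x ≟ᶠ y)
... | yes hit = hit
... | no miss = contradiction
  (injective⇒≤ {f = punchOut ∘ avoid} (inj ∘ punchOut-injective (avoid _) (avoid _)))
  1+n≰n
  where
  avoid : ∀ x → y ≢ f x
  avoid x eq = miss (x , sym eq)

-- The pigeonhole principle on a decidable subset `S`: choosing an `F`-successor maps `S`
-- injectively into itself. `F` is a relation so that it can carry the woman who links one man to
-- the next.
injective-relation⇒onto : ∀ {n} {S : Fin n → Set} {F : Fin n → Fin n → Set} →
  (∀ x → Dec (S x)) →
  (∀ x → S x → ∃[ y ] S y × F x y) →
  (∀ {x y z} → F x z → F y z → x ≡ y) →
  ∀ y → S y → ∃[ x ] F x y
injective-relation⇒onto {n} {S} {F} S? total inj y Sy = go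
  where
  -- F restricted to S, extended by the identity outside S.
  Extended : Fin n → Fin n → Set
  Extended x z = (S z × F x z) ⊎ (¬ S x × x ≡ z)

  extend : ∀ x → ∃[ z ] Extended x z
  extend x with S? x
  ... | no ¬Sx = x , inj₂ (¬Sx , refl)
  ... | yes Sx with z , h ← total x Sx = z , inj₁ h

  extend-injective : ∀ {x x′} (e : ∃[ z ] Extended x z) (e′ : ∃[ z ] Extended x′ z) →
                     proj₁ e ≡ proj₁ e′ → x ≡ x′
  extend-injective (_ , inj₁ (_ , h))     (_ , inj₁ (_ , h′))    refl = inj h h′
  extend-injective (_ , inj₁ (Sz , _))    (_ , inj₂ (¬S , refl)) refl = contradiction Sz ¬S
  extend-injective (_ , inj₂ (¬S , refl)) (_ , inj₁ (Sz , _))    refl = contradiction Sz ¬S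
  extend-injective (_ , inj₂ (_ , refl))  (_ , inj₂ (_ , refl))  refl = refl

  go : ∃[ x ] F x y
  go with x , eq ← injective⇒onto {f = proj₁ ∘ extend} (extend-injective (extend _) (extend _)) y
     with extend x
  ... | z , inj₁ (_ , h)      = x , subst (F x) eq h
  ... | z , inj₂ (¬Sx , refl) = contradiction (subst S (sym eq) Sy) ¬Sx

-- Meant for the rows of a matching: with at most one element in `p`, only emptiness has to be
-- compared.
∣∣-mono-unique : ∀ {n} {p q : Subset n} → (∀ {x y} → x ∈ p → y ∈ p → x ≡ y) →
                 (Nonempty p → Nonempty q) → ∣ p ∣ ≤ ∣ q ∣
∣∣-mono-unique {n} {p} {q} unique h with nonempty? p
... | no empty = ≤-trans (≤-reflexive (trans (cong ∣_∣ (Empty-unique empty)) (∣⊥∣≡0 n))) z≤n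
... | yes (x , x∈p) with y , y∈q ← h (x , x∈p) = begin
  ∣ p ∣      ≤⟨ p⊆q⇒∣p∣≤∣q∣ (λ z∈p → subst (_∈ ⁅ x ⁆) (unique x∈p z∈p) (x∈⁅x⁆ x)) ⟩
  ∣ ⁅ x ⁆ ∣  ≡⟨ trans (∣⁅x⁆∣≡1 x) (sym (∣⁅x⁆∣≡1 y)) ⟩
  ∣ ⁅ y ⁆ ∣  ≤⟨ p⊆q⇒∣p∣≤∣q∣ (λ z∈y → subst (_∈ q) (sym (x∈⁅y⁆⇒x≡y y z∈y)) y∈q) ⟩
  ∣ q ∣      ∎
  where open ≤-Reasoning

x∈p─q⇒x∉q : ∀ {n} {x : Fin n} (p q : Subset n) → x ∈ p ─ q → x ∉ q
x∈p─q⇒x∉q (_ ∷ p) (inside ∷ q)  (there h) (there h′) = x∈p─q⇒x∉q p q h h′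
x∈p─q⇒x∉q (_ ∷ p) (outside ∷ q) (there h) (there h′) = x∈p─q⇒x∉q p q h h′

-- Weights and cardinalities of sets of pairs

sumℕ : ∀ {n} → (Fin n → ℕ) → ℕ
sumℕ = sum +-0-commutativeMonoid

sum-mono : ∀ {n} {f g : Fin n → ℕ} → (∀ i → f i ≤ g i) → sumℕ f ≤ sumℕ g
sum-mono {zero}  h = z≤n
sum-mono {suc n} h = +-mono-≤ (h zero) (sum-mono (h ∘ suc))

row-split : ∀ {n} (p q : Subset n) →
  sumℕ (λ x → if does (x ∈? q) then (if does (x ∈? p) then 1 else 0) else 0) + ∣ p ─ q ∣ ≡ ∣ p ∣
row-split []            []            = refl
row-split (inside ∷ p)  (inside ∷ q)  = cong suc (row-split p q)
row-split (outside ∷ p) (inside ∷ q)  = row-split p q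
row-split (inside ∷ p)  (outside ∷ q) = trans (+-suc _ _) (cong suc (row-split p q))
row-split (outside ∷ p) (outside ∷ q) = row-split p q

-- The weight of `M` is the number of pairs of `K` that it keeps, so maximizing the weight is the
-- same as minimizing the number of lost pairs.
weight+card : ∀ {m n} (K M : PairSet m n) →
              totalWeight (indicator K) M + card (K ∖ M) ≡ card K
weight+card K M = trans
  (sym (∑-distrib-+ +-0-commutativeMonoid _ (λ u → ∣ K u ─ M u ∣)))
  (sum-cong-≗ +-0-commutativeMonoid (λ u → row-split (K u) (M u)))

weight-mono : ∀ {m n} (K M M′ : PairSet m n) → (∀ {u w} → w ∈ M u → w ∈ K u → w ∈ M′ u) →
              totalWeight (indicator K) M ≤ totalWeight (indicator K) M′
weight-mono K M M′ h = sum-mono λ u → sum-mono (entry u)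
  where
  entry : ∀ u w → (if does (w ∈? M u) then indicator K u w else 0)
                ≤ (if does (w ∈? M′ u) then indicator K u w else 0)
  entry u w with w ∈? M u | w ∈? K u | w ∈? M′ u
  ... | no _  | _     | _     = z≤n
  ... | yes _ | no _  | yes _ = z≤n
  ... | yes _ | no _  | no _  = z≤n
  ... | yes _ | yes _ | yes _ = s≤s z≤n
  ... | yes a | yes b | no c  = contradiction (h a b) c

card∖-antitone : ∀ {m n} (K M M′ : PairSet m n) →
  totalWeight (indicator K) M′ ≤ totalWeight (indicator K) M → card (K ∖ M) ≤ card (K ∖ M′)
card∖-antitone K M M′ h = +-cancelˡ-≤ (totalWeight (indicator K) M) _ _ (begin
  totalWeight (indicator K) M + card (K ∖ M)    ≡⟨ weight+card K M ⟩
  card K                                        ≡⟨ weight+card K M′ ⟨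
  totalWeight (indicator K) M′ + card (K ∖ M′)  ≤⟨ +-monoˡ-≤ _ h ⟩
  totalWeight (indicator K) M + card (K ∖ M′)   ∎)
  where open ≤-Reasoning

-- Stable matchings

module Stability {m n : ℕ} (P : Preferences m n) where
  open Preferences P public
  module Man (u : Fin m) = IsStrictTotalOrder (manOrder u)
  module Woman (w : Fin n) = IsStrictTotalOrder (womanOrder w)

  man-asym : ∀ {u w w′} → ManPrefers u w w′ → ¬ ManPrefers u w′ w
  man-asym {u} = Man.asym u

  woman-asym : ∀ {w u u′} → WomanPrefers w u u′ → ¬ WomanPrefers w u′ u
  woman-asym {w} = Woman.asym w

  man-irrefl : ∀ {u w w′} → w ≡ w′ → ¬ ManPrefers u w w′
  man-irrefl {u} = Man.irrefl u

  woman-irrefl : ∀ {w u u′} → u ≡ u′ → ¬ WomanPrefers w u u′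
  woman-irrefl {w} = Woman.irrefl w

  man-trans : ∀ {u w w′ w″} → ManPrefers u w w′ → ManPrefers u w′ w″ → ManPrefers u w w″
  man-trans {u} = Man.trans u

  -- The positive form of "(u , w) does not block M".
  Calm : PairSet m n → Fin m → Fin n → Set
  Calm M u w = w ∈ M u
             ⊎ (∃[ w′ ] w′ ∈ M u × ManPrefers u w′ w)
             ⊎ (∃[ u′ ] w ∈ M u′ × WomanPrefers w u′ u)

  -- Membership is decidable and preferences are trichotomous, so the absence of a blocking pair can
  -- be turned into an explicit reason: one of the two persons has a better partner, or they are
  -- matched.
  stable⇒calm : ∀ {W M} → IsStable P W M → ∀ u {w} → w ∈ W → Calm M u w
  stable⇒calm {W} {M} st u {w} w∈W with w ∈? M u
  ... | yes h = inj₁ h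
  ... | no w∉Mu = man
    where
    open IsStable st
    woman : (∀ w′ → w′ ∉ M u) ⊎ (∃[ w′ ] w′ ∈ M u × ManPrefers u w w′) → Calm M u w
    woman wants with any? (λ u′ → w ∈? M u′)
    ... | no none = ⊥-elim (unblocked u w (record
      { present = w∈W ; not-matched = w∉Mu ; man-wants = wants
      ; woman-wants = inj₁ λ u′ h → none (u′ , h) }))
    ... | yes (u′ , h) with Woman.compare w u u′
    ...   | tri< u≻u′ _ _ = ⊥-elim (unblocked u w (record
      { present = w∈W ; not-matched = w∉Mu ; man-wants = wants
      ; woman-wants = inj₂ (u′ , h , u≻u′) }))
    ...   | tri≈ _ refl _ = inj₁ h
    ...   | tri> _ _ u′≻u = inj₂ (inj₂ (u′ , h , u′≻u))

    man : Calm M u w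
    man with nonempty? (M u)
    ... | no none = woman (inj₁ λ w′ h → none (w′ , h))
    ... | yes (w′ , h) with Man.compare u w w′
    ...   | tri< w≻w′ _ _ = woman (inj₂ (w′ , h , w≻w′))
    ...   | tri≈ _ refl _ = inj₁ h
    ...   | tri> _ _ w′≻w = inj₂ (inj₁ (w′ , h , w′≻w))

  calm⇒stable : ∀ {W M} → IsMatching W M → (∀ u w → w ∈ W → Calm M u w) → IsStable P W M
  calm⇒stable {W} {M} mat calm = record { isMatching = mat ; unblocked = unblocked }
    where
    open IsMatching mat
    unblocked : ∀ u w → ¬ Blocking P W M u w
    unblocked u w bl with calm u w (Blocking.present bl)
    ... | inj₁ h = Blocking.not-matched bl h
    ... | inj₂ (inj₁ (w′ , h , w′≻w)) with Blocking.man-wants bl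
    ...   | inj₁ none = none w′ h
    ...   | inj₂ (w″ , h″ , w≻w″) with refl ← man-unique h h″ = man-asym w≻w″ w′≻w
    unblocked u w bl | inj₂ (inj₂ (u′ , h , u′≻u)) with Blocking.woman-wants bl
    ...   | inj₁ none = none u′ h
    ...   | inj₂ (u″ , h″ , u≻u″) with refl ← woman-unique h h″ = woman-asym u≻u″ u′≻u

  _≽⟨_⟩_ : Fin n → Fin m → Fin n → Set
  w′ ≽⟨ u ⟩ w = w′ ≡ w ⊎ ManPrefers u w′ w

  module Join {W₁ : Subset n} {M₁ M₂ : PairSet m n}
              (st₁ : IsStable P W₁ M₁) (st₂ : IsStable P ⊤ M₂) where
    private
      module M₁ = IsMatching (IsStable.isMatching st₁)
      module M₂ = IsMatching (IsStable.isMatching st₂)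

    -- A man matched in `M₁` but single in `M₂` counts as improving, the condition on his
    -- `M₂`-partners being vacuous.
    Improves : Fin m → Set
    Improves u = ∃[ w ] w ∈ M₁ u × (∀ w′ → w′ ∈ M₂ u → ManPrefers u w w′)

    improves? : ∀ u → Dec (Improves u)
    improves? u = any? λ w → (w ∈? M₁ u) ×-dec
                    all? λ w′ → (w′ ∈? M₂ u) →-dec Man._<?_ u w w′

    join : PairSet m n
    join u = if does (improves? u) then M₁ u else M₂ u

    ∈join⁻ : ∀ {u w} → w ∈ join u → (Improves u × w ∈ M₁ u) ⊎ (¬ Improves u × w ∈ M₂ u)
    ∈join⁻ {u} h with improves? u
    ... | yes i = inj₁ (i , h)
    ... | no ¬i = inj₂ (¬i , h)

    ∈join⁺₁ : ∀ {u w} → Improves u → w ∈ M₁ u → w ∈ join u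
    ∈join⁺₁ {u} i h with improves? u
    ... | yes _ = h
    ... | no ¬i = contradiction i ¬i

    ∈join⁺₂ : ∀ {u w} → ¬ Improves u → w ∈ M₂ u → w ∈ join u
    ∈join⁺₂ {u} ¬i h with improves? u
    ... | yes i = contradiction i ¬i
    ... | no _  = h

    improvement : ∀ {u w w′} → Improves u → w ∈ M₁ u → w′ ∈ M₂ u → ManPrefers u w w′
    improvement (_ , h , better) w∈ w′∈ with refl ← M₁.man-unique h w∈ = better _ w′∈

    no-improvement : ∀ {u w} → ¬ Improves u → w ∈ M₁ u → ∃[ w′ ] w′ ∈ M₂ u × w′ ≽⟨ u ⟩ w
    no-improvement {u} {w} ¬i w∈ with nonempty? (M₂ u)
    ... | no none = contradiction (w , w∈ , λ w′ h → contradiction (w′ , h) none) ¬i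
    ... | yes (w′ , h) with Man.compare u w w′
    ...   | tri< w≻w′ _ _ = contradiction
      (w , w∈ , λ w″ h″ → subst (ManPrefers u w) (M₂.man-unique h h″) w≻w′) ¬i
    ...   | tri≈ _ refl _ = w′ , h , inj₁ refl
    ...   | tri> _ _ w′≻w = w′ , h , inj₂ w′≻w

    -- Since `(u , w)` does not block `M₂` although `u` would gain, `w` has a better man `u′` there.
    -- Since `(u′ , w)` does not block `M₁`, where `w` has only `u`, the man `u′` must do better
    -- than `w` in `M₁`, so he improves as well.
    takeover : ∀ {u w} → Improves u → w ∈ M₁ u → ∃[ u′ ] Improves u′ × w ∈ M₂ u′
    takeover {u} {w} i w∈ with stable⇒calm st₂ u {w} ∈⊤
    ... | inj₁ h = contradiction (improvement i w∈ h) (man-irrefl refl)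
    ... | inj₂ (inj₁ (w′ , h , w′≻w)) = contradiction (improvement i w∈ h) (man-asym w′≻w)
    ... | inj₂ (inj₂ (u′ , h , u′≻u)) with stable⇒calm st₁ u′ (M₁.within w∈)
    ...   | inj₁ h′ = contradiction u′≻u (woman-irrefl (M₁.woman-unique h′ w∈))
    ...   | inj₂ (inj₁ (w″ , h″ , w″≻w)) =
      u′ , (w″ , h″ , λ w′ h′ → subst (ManPrefers u′ w″) (M₂.man-unique h h′) w″≻w) , h
    ...   | inj₂ (inj₂ (u″ , h″ , u″≻u′)) with refl ← M₁.woman-unique h″ w∈ =
      contradiction u″≻u′ (woman-asym u′≻u)

    -- By `takeover`, passing to the `M₂`-partner of the `M₁`-partner maps the improving men
    -- injectively to themselves, hence onto. So a woman abandoned by an improving man is taken by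
    -- another one or by himself.
    takeover-onto : ∀ {u′ w} → Improves u′ → w ∈ M₂ u′ → ∃[ u ] Improves u × w ∈ M₁ u
    takeover-onto {u′} i w∈
      with u , w′ , j , h , h′ ← injective-relation⇒onto
             {F = λ u u′ → ∃[ w ] Improves u × w ∈ M₁ u × w ∈ M₂ u′} improves?
             (λ u j → let (w , h , _) = j ; (u′ , j′ , h′) = takeover j h in u′ , j′ , w , j , h , h′)
             (λ { (w , _ , h , k) (w′ , _ , h′ , k′) →
                  M₁.woman-unique h (subst (_∈ M₁ _) (M₂.man-unique k′ k) h′) })
             u′ i
      with refl ← M₂.man-unique w∈ h′ = u , j , h

    join-isMatching : IsMatching ⊤ join
    join-isMatching = record
      { within       = λ _ → ∈⊤
      ; man-unique   = λ h h′ → man (∈join⁻ h) (∈join⁻ h′)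
      ; woman-unique = λ h h′ → woman (∈join⁻ h) (∈join⁻ h′)
      }
      where
      Origin : Fin m → Fin n → Set
      Origin u w = (Improves u × w ∈ M₁ u) ⊎ (¬ Improves u × w ∈ M₂ u)

      man : ∀ {u w w′} → Origin u w → Origin u w′ → w ≡ w′
      man (inj₁ (_ , h))  (inj₁ (_ , h′))  = M₁.man-unique h h′
      man (inj₁ (i , _))  (inj₂ (¬i , _))  = contradiction i ¬i
      man (inj₂ (¬i , _)) (inj₁ (i , _))   = contradiction i ¬i
      man (inj₂ (_ , h))  (inj₂ (_ , h′))  = M₂.man-unique h h′

      -- A woman could get two men only if her `M₁`-man improves and her `M₂`-man does not;
      -- `takeover` excludes this.
      crossed : ∀ {u u′ w} → Improves u → w ∈ M₁ u → w ∈ M₂ u′ → Improves u′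
      crossed i h h′ with u″ , i″ , h″ ← takeover i h
                     with refl ← M₂.woman-unique h′ h″ = i″

      woman : ∀ {u u′ w} → Origin u w → Origin u′ w → u ≡ u′
      woman (inj₁ (_ , h))  (inj₁ (_ , h′))  = M₁.woman-unique h h′
      woman (inj₁ (i , h))  (inj₂ (¬i , h′)) = contradiction (crossed i h h′) ¬i
      woman (inj₂ (¬i , h)) (inj₁ (i , h′))  = contradiction (crossed i h′ h) ¬i
      woman (inj₂ (_ , h))  (inj₂ (_ , h′))  = M₂.woman-unique h h′

    join-calm : ∀ u w → Calm join u w
    join-calm u w = decide (stable⇒calm st₂ u ∈⊤) (improves? u)
      where
      decide : Calm M₂ u w → Dec (Improves u) → Calm join u w
      decide (inj₁ h) (no ¬i) = inj₁ (∈join⁺₂ ¬i h)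
      decide (inj₁ h) (yes i@(w₀ , h₀ , _)) =
        inj₂ (inj₁ (w₀ , ∈join⁺₁ i h₀ , improvement i h₀ h))
      decide (inj₂ (inj₁ (w′ , h , w′≻w))) (no ¬i) = inj₂ (inj₁ (w′ , ∈join⁺₂ ¬i h , w′≻w))
      decide (inj₂ (inj₁ (w′ , h , w′≻w))) (yes i@(w₀ , h₀ , _)) =
        inj₂ (inj₁ (w₀ , ∈join⁺₁ i h₀ , man-trans (improvement i h₀ h) w′≻w))
      decide (inj₂ (inj₂ (u′ , h , u′≻u))) i? with improves? u′
      ... | no ¬i′ = inj₂ (inj₂ (u′ , ∈join⁺₂ ¬i′ h , u′≻u))
      -- The better man `u′` who protected the pair in `M₂` has left `w`. By `takeover-onto` she now
      -- has her `M₁`-man, so she belongs to `W₁`, and the stability of `M₁` at `(u , w)` supplies a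
      -- new reason.
      ... | yes i′ with u₀ , i₀ , h₀ ← takeover-onto i′ h with stable⇒calm st₁ u (M₁.within h₀) | i?
      ...   | inj₁ h₁ | _ with refl ← M₁.woman-unique h₁ h₀ = inj₁ (∈join⁺₁ i₀ h₀)
      ...   | inj₂ (inj₂ (u″ , h″ , u″≻u)) | _ with refl ← M₁.woman-unique h″ h₀ =
        inj₂ (inj₂ (u″ , ∈join⁺₁ i₀ h₀ , u″≻u))
      ...   | inj₂ (inj₁ (w″ , h″ , w″≻w)) | yes i = inj₂ (inj₁ (w″ , ∈join⁺₁ i h″ , w″≻w))
      ...   | inj₂ (inj₁ (w″ , h″ , w″≻w)) | no ¬i with no-improvement ¬i h″
      ...     | w₂ , h₂ , inj₁ refl  = inj₂ (inj₁ (w₂ , ∈join⁺₂ ¬i h₂ , w″≻w))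
      ...     | w₂ , h₂ , inj₂ w₂≻w″ = inj₂ (inj₁ (w₂ , ∈join⁺₂ ¬i h₂ , man-trans w₂≻w″ w″≻w))

    join-stable : IsStable P ⊤ join
    join-stable = calm⇒stable join-isMatching λ u w _ → join-calm u w

    join-improves : ∀ {u w} → w ∈ M₁ u → ∃[ w′ ] w′ ∈ join u × w′ ≽⟨ u ⟩ w
    join-improves {u} {w} h with improves? u
    ... | yes i = w , h , inj₁ refl
    ... | no ¬i = no-improvement ¬i h

    join-common : ∀ {u w} → w ∈ M₁ u → w ∈ M₂ u → w ∈ join u
    join-common {u} h h′ with improves? u
    ... | yes _ = h
    ... | no _  = h′

    join-changed : ∀ {u w} → w ∈ M₁ u → w ∉ join u → ∃[ w′ ] w′ ∈ M₂ u × ManPrefers u w′ w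
    join-changed {u} h w∉ with improves? u
    ... | yes i = contradiction h w∉
    ... | no ¬i with no-improvement ¬i h
    ...   | w′ , h′ , inj₁ refl = contradiction h′ w∉
    ...   | w′ , h′ , inj₂ w′≻w = w′ , h′ , w′≻w

  -- Let `w` be the `M*`-partner of `u`. As `u` cannot do better than `w` in the stable `M`, she is
  -- matched in `M`, to a man who by `best` is matched in `M*` too. This maps the men of `M*`
  -- injectively to themselves, hence onto, and every man in the image is matched in `M`.
  menOptimal-matched : ∀ {W M* M} → IsMenOptimal P W M* → IsStable P W M →
                       ∀ {u w} → w ∈ M* u → ∃[ w′ ] w′ ∈ M u
  menOptimal-matched {W} {M*} {M} opt st {u} w∈ =
    let x , w , _ , h = injective-relation⇒onto
          {S = λ u → ∃[ w ] w ∈ M* u} {F = λ u u′ → ∃[ w ] w ∈ M* u × w ∈ M u′}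
          (λ u → nonempty? (M* u)) rematch
          (λ { (w , h , k) (w′ , h′ , k′) →
               M*.woman-unique h (subst (_∈ M* _) (M.man-unique k′ k) h′) })
          u (_ , w∈)
    in w , h
    where
    module M* = IsMatching (IsStable.isMatching (IsMenOptimal.isStable opt))
    module M = IsMatching (IsStable.isMatching st)
    open IsMenOptimal opt using (best)

    rematch : ∀ u → ∃[ w ] w ∈ M* u →
              ∃[ u′ ] (∃[ w ] w ∈ M* u′) × (∃[ w ] w ∈ M* u × w ∈ M u′)
    rematch u (w , h) with stable⇒calm st u (M*.within h)
    ... | inj₁ h′ = u , (w , h) , w , h , h′
    ... | inj₂ (inj₁ (w′ , h′ , w′≻w)) with best u w′ (M , st , h′)
    ...   | w″ , h″ , inj₁ refl = contradiction w′≻w (man-irrefl (M*.man-unique h″ h))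
    ...   | w″ , h″ , inj₂ w″≻w′ with refl ← M*.man-unique h″ h =
      contradiction w″≻w′ (man-asym w′≻w)
    rematch u (w , h) | inj₂ (inj₂ (u′ , h′ , _)) with w″ , h″ , _ ← best u′ w (M , st , h′) =
      u′ , (w″ , h″) , w , h , h′

-- Optimality of the two-stage algorithm

opt2Stage⇒optimal : ∀ {m n} (P : Preferences m n) {W₁ M₁ M₂} →
                    Opt2Stage P W₁ M₁ M₂ → IsOptimal P W₁ M₁ M₂
opt2Stage⇒optimal P {W₁} {M₁} {M₂} opt = record
  { stable₁ = st₁
  ; stable₂ = IsMaxWeightStable.isStable stage₂
  ; minimal = minimal
  }
  where
  open Stability P
  open Opt2Stage opt
  st₁ = IsMenOptimal.isStable stage₁
  open IsMenOptimal stage₁ using (best)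
  module M₁ = IsMatching (IsStable.isMatching st₁)

  minimal : ∀ M₁′ M₂′ → IsStable P W₁ M₁′ → IsStable P ⊤ M₂′ → card (M₁ ∖ M₂) ≤ card (M₁′ ∖ M₂′)
  -- Maximum weight lets `M₂` lose no more pairs of `M₁` than `M₁′ ∨ M₂′` does. Those losses are
  -- then compared man by man with the losses of `M₁′` against `M₂′`.
  minimal M₁′ M₂′ st₁′ st₂′ = ≤-trans
    (card∖-antitone M₁ M₂ join (IsMaxWeightStable.maximal stage₂ join join-stable))
    (sum-mono λ u → ∣∣-mono-unique
      (λ h h′ → M₁.man-unique (p─q⊆p (M₁ u) (join u) h) (p─q⊆p (M₁ u) (join u) h′))
      (row u))
    where
    open Join st₁ st₂′
    module M₁′ = IsMatching (IsStable.isMatching st₁′)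
    module M₂′ = IsMatching (IsStable.isMatching st₂′)

    row : ∀ u → Nonempty (M₁ u ─ join u) → Nonempty (M₁′ u ─ M₂′ u)
    row u (w , h)
      with w∈M₁ ← p─q⊆p (M₁ u) (join u) h
      with w′ , w′∈M₂′ , w′≻w ← join-changed w∈M₁ (x∈p─q⇒x∉q (M₁ u) (join u) h)
      with w″ , w″∈M₁′ ← menOptimal-matched stage₁ st₁′ w∈M₁
      with w₀ , w₀∈M₁ , w₀≽w″ ← best u w″ (M₁′ , st₁′ , w″∈M₁′)
      with refl ← M₁.man-unique w₀∈M₁ w∈M₁ =
      w″ , x∈p∧x∉q⇒x∈p─q w″∈M₁′ (λ w″∈M₂′ → worse w₀≽w″ (M₂′.man-unique w″∈M₂′ w′∈M₂′) w′≻w)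
      where
      worse : ∀ {w w′ w″} → w ≽⟨ u ⟩ w″ → w″ ≡ w′ → ¬ ManPrefers u w′ w
      worse (inj₁ refl) refl = man-irrefl refl
      worse (inj₂ w≻w″) refl = man-asym w≻w″

-- Deferred acceptance

-- rk i j is the rank of receiver j for proposer i, and rr j i that of i for
-- j.  A pair (i , j) of K acts as a permanent proposal of i to j.

record Market (a b : ℕ) : Set₁ where
  field
    rk : Fin a → Fin b → ℕ
    rr : Fin b → Fin a → ℕ
    K  : Fin a → Fin b → Set
    rk-injective : ∀ {i j j′} → rk i j ≡ rk i j′ → j ≡ j′
    rk-bounded   : ∀ i j → rk i j < b
    rr-injective : ∀ {j i i′} → rr j i ≡ rr j i′ → i ≡ i′

module DeferredAcceptance {a b : ℕ} (market : Market a b) where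
  open Market market

  -- The ranks in a list of length `b` are `b` distinct numbers below `b`, so all of them occur.
  rk-onto : ∀ i {k} → k < b → ∃[ j ] rk i j ≡ k
  rk-onto i {k} k<b =
    let j , eq = injective⇒onto {f = λ j → fromℕ< (rk-bounded i j)}
                   (rk-injective ∘ fromℕ<-injective _ _ _ _) (fromℕ< k<b)
    in j , fromℕ<-injective _ _ _ _ eq

  -- The matchings with which the outcome is compared: stable ones in which no receiver would rather
  -- take a permanent proposal made to him.
  record Candidate (M : Fin a → Fin b → Set) : Set where
    field
      unique   : ∀ {i i′ j} → M i j → M i′ j → i ≡ i′
      calm     : ∀ i j → M i j
               ⊎ (∃[ j′ ] M i j′ × rk i j′ < rk i j)
               ⊎ (∃[ i′ ] M i′ j × rr j i′ < rr j i)
      respects : ∀ {i i′ j} → K i′ j → M i j → ¬ rr j i′ < rr j i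

  -- q i is the rank in i's list of the receiver to whom i proposes.
  record Conflict (q : Fin a → ℕ) (i i′ : Fin a) (j : Fin b) : Set where
    constructor conflict
    field
      points    : rk i j ≡ q i
      beaten    : rr j i′ < rr j i
      contender : K i′ j ⊎ rk i′ j ≡ q i′

  Stuck : (Fin a → ℕ) → Set
  Stuck q = ∀ i i′ j → ¬ Conflict q i i′ j

  -- `settled` says that every skipped receiver currently has a better offer, `safe` that no pointer
  -- has moved past a partner in a candidate. A pointer equal to `b` means an exhausted list.
  record Inv (q : Fin a → ℕ) : Set₁ where
    field
      bounded : ∀ i → q i ≤ b
      settled : ∀ i j → rk i j < q i → ∃[ i′ ] rr j i′ < rr j i × (K i′ j ⊎ rk i′ j ≡ q i′)
      safe    : ∀ {M} → Candidate M → ∀ {i j} → M i j → q i ≤ rk i j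

  conflict-resp : ∀ {q q′ i i′ j} → (∀ v → q v ≡ q′ v) → Conflict q i i′ j → Conflict q′ i i′ j
  conflict-resp {i = i} {i′} eq (conflict p b (inj₁ k)) = conflict (trans p (eq i)) b (inj₁ k)
  conflict-resp {i = i} {i′} eq (conflict p b (inj₂ r)) =
    conflict (trans p (eq i)) b (inj₂ (trans r (eq i′)))

  Inv-resp : ∀ {q q′} → (∀ v → q v ≡ q′ v) → Inv q → Inv q′
  Inv-resp {q} {q′} eq inv = record
    { bounded = λ i → subst (_≤ b) (eq i) (bounded i)
    ; settled = settled′
    ; safe    = λ cand {i} {j} h → subst (_≤ rk i j) (eq i) (safe cand h)
    }
    where
    open Inv inv
    settled′ : ∀ i j → rk i j < q′ i → ∃[ i′ ] rr j i′ < rr j i × (K i′ j ⊎ rk i′ j ≡ q′ i′)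
    settled′ i j h with settled i j (subst (rk i j <_) (sym (eq i)) h)
    ... | i′ , lt , inj₁ k = i′ , lt , inj₁ k
    ... | i′ , lt , inj₂ r = i′ , lt , inj₂ (trans r (eq i′))

  Inv-zero : ∀ {q} → (∀ i → q i ≡ 0) → Inv q
  Inv-zero eq = Inv-resp (λ v → sym (eq v)) (record
    { bounded = λ _ → z≤n ; settled = λ _ _ () ; safe = λ _ _ → z≤n })

  -- Only `i` moves, past the single receiver `j`. A new argument is required for this pair, and
  -- wherever the old proposal of `i` served as the better offer.
  Inv-step : ∀ {q q′ i i′ j} → Conflict q i i′ j → q′ i ≡ suc (q i) →
             (∀ v → v ≢ i → q′ v ≡ q v) → Inv q → Inv q′
  Inv-step {q} {q′} {i} {i′} {j} (conflict points beaten contender) up same inv = record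
    { bounded = bounded′ ; settled = settled′ ; safe = safe′ }
    where
    open Inv inv

    i′≢i : i′ ≢ i
    i′≢i refl = <-irrefl refl beaten

    contender′ : K i′ j ⊎ rk i′ j ≡ q′ i′
    contender′ = Sum.map₂ (λ r → trans r (sym (same i′ i′≢i))) contender

    bounded′ : ∀ v → q′ v ≤ b
    bounded′ v with v ≟ᶠ i
    ... | yes refl = subst (_≤ b) (trans (cong suc points) (sym up)) (rk-bounded i j)
    ... | no v≢i   = subst (_≤ b) (sym (same v v≢i)) (bounded v)

    -- If the better offer was the proposal just withdrawn, then `l` is `j`, and the rival `i′` is a
    -- better offer still.
    renew : ∀ v l → ∃[ z ] rr l z < rr l v × (K z l ⊎ rk z l ≡ q z) →
            ∃[ z ] rr l z < rr l v × (K z l ⊎ rk z l ≡ q′ z)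
    renew v l (z , lt , inj₁ k) = z , lt , inj₁ k
    renew v l (z , lt , inj₂ r) with z ≟ᶠ i
    ... | no z≢i = z , lt , inj₂ (trans r (sym (same z z≢i)))
    ... | yes refl with refl ← rk-injective (trans r (sym points)) =
      i′ , <-trans beaten lt , contender′

    settled′ : ∀ v l → rk v l < q′ v → ∃[ z ] rr l z < rr l v × (K z l ⊎ rk z l ≡ q′ z)
    settled′ v l h with v ≟ᶠ i
    ... | no v≢i = renew v l (settled v l (subst (rk v l <_) (same v v≢i) h))
    ... | yes refl with m≤n⇒m<n∨m≡n (≤-pred (subst (rk v l <_) up h))
    ...   | inj₁ lt = renew v l (settled v l lt)
    ...   | inj₂ eq with refl ← rk-injective (trans eq (sym points)) = i′ , beaten , contender′

    -- A permanent rival is excluded by `respects`. A rival pointing at `j` has no better partner in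
    -- `M` by `safe`, so for `M` to be calm at `(i′ , j)` the partner of `j` must be `i′` or better;
    -- but that partner is `i`, whom `i′` beats.
    rejected : ∀ {M} → Candidate M → K i′ j ⊎ rk i′ j ≡ q i′ → ¬ M i j
    rejected cand (inj₁ k) h = Candidate.respects cand k h beaten
    rejected cand (inj₂ r) h with Candidate.calm cand i′ j
    ... | inj₁ h′ = i′≢i (Candidate.unique cand h′ h)
    ... | inj₂ (inj₁ (l , h′ , lt)) = <⇒≱ lt (subst (_≤ rk i′ l) (sym r) (safe cand h′))
    ... | inj₂ (inj₂ (z , h′ , lt)) with refl ← Candidate.unique cand h′ h = <-asym lt beaten

    safe′ : ∀ {M} → Candidate M → ∀ {v l} → M v l → q′ v ≤ rk v l
    safe′ cand {v} {l} h with v ≟ᶠ i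
    ... | no v≢i = subst (_≤ rk v l) (sym (same v v≢i)) (safe cand h)
    ... | yes refl with m≤n⇒m<n∨m≡n (safe cand h)
    ...   | inj₁ lt = subst (_≤ rk v l) (sym up) lt
    ...   | inj₂ eq with refl ← rk-injective (trans points eq) = contradiction h (rejected cand contender)

  module Outcome {q : Fin a → ℕ} (inv : Inv q) (stuck : Stuck q) where
    open Inv inv

    Points : Fin a → Fin b → Set
    Points i j = rk i j ≡ q i

    proposer-unique : ∀ {i j j′} → Points i j → Points i j′ → j ≡ j′
    proposer-unique h h′ = rk-injective (trans h (sym h′))

    unbeaten : ∀ {i i′ j} → Points i j → K i′ j ⊎ Points i′ j → ¬ rr j i′ < rr j i
    unbeaten h h′ lt = stuck _ _ _ (conflict h lt h′)

    receiver-unique : ∀ {i i′ j} → Points i j → Points i′ j → i ≡ i′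
    receiver-unique {i} {i′} {j} h h′ with <-cmp (rr j i) (rr j i′)
    ... | tri< lt _ _ = contradiction lt (unbeaten h′ (inj₂ h))
    ... | tri≈ _ eq _ = rr-injective eq
    ... | tri> _ _ gt = contradiction gt (unbeaten h (inj₂ h′))

    -- A pointer strictly before the rank of `j` is below `b`, so it designates an actual receiver,
    -- whom `i` prefers to `j`.
    reached : ∀ {i j} → q i ≤ rk i j → Points i j ⊎ (∃[ j′ ] Points i j′ × rk i j′ < rk i j)
    reached {i} {j} h with m≤n⇒m<n∨m≡n h
    ... | inj₂ eq = inj₁ (sym eq)
    ... | inj₁ lt with j′ , eq ← rk-onto i (<-trans lt (rk-bounded i j)) =
      inj₂ (j′ , eq , subst (_< rk i j) (sym eq) lt)

    -- In the last alternative the better offer may be a mere permanent proposal. Stability of the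
    -- outcome then depends on what the receiver really gets, which is settled separately in each
    -- stage.
    outcome-calm : ∀ i j → Points i j
                 ⊎ (∃[ j′ ] Points i j′ × rk i j′ < rk i j)
                 ⊎ (∃[ i′ ] (K i′ j ⊎ Points i′ j) × rr j i′ < rr j i)
    outcome-calm i j with <-cmp (rk i j) (q i)
    ... | tri< lt _ _ = let i′ , lt′ , h = settled i j lt in inj₂ (inj₂ (i′ , h , lt′))
    ... | tri≈ _ eq _ = inj₁ eq
    ... | tri> _ _ gt with reached (<⇒≤ gt)
    ...   | inj₁ h = inj₁ h
    ...   | inj₂ h = inj₂ (inj₁ h)

    -- Proposer-optimality among the candidates, read off from `safe`.
    outcome-best : ∀ {M} → Candidate M → ∀ {i j} → M i j →
                   Points i j ⊎ (∃[ j′ ] Points i j′ × rk i j′ < rk i j)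
    outcome-best cand h = reached (safe cand h)

-- Deferred acceptance as a program

sum-mono-< : ∀ {n} {f g : Fin n → ℕ} i → (∀ k → f k ≤ g k) → f i < g i → sumℕ f < sumℕ g
sum-mono-< zero    h lt = +-mono-<-≤ lt (sum-mono (h ∘ suc))
sum-mono-< (suc i) h lt = +-mono-≤-< (h zero) (sum-mono-< i (h ∘ suc) lt)

sum-const : ∀ n c → sumℕ {n} (λ _ → c) ≡ n * c
sum-const zero    c = refl
sum-const (suc n) c = cong (c +_) (sum-const n c)

below-suc : ∀ {N} (x : Fin N) {Q : Fin N → Set} → (∀ y → toℕ y < toℕ x → Q y) → Q x →
         ∀ y → toℕ y < suc (toℕ x) → Q y
below-suc x {Q} h hx y lt with m≤n⇒m<n∨m≡n (≤-pred lt)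
... | inj₁ lt′ = h y lt′
... | inj₂ eq  = subst Q (sym (toℕ-injective eq)) hx

-- The absolute difference under truncated subtraction. Programs can only test `<`, so equality is
-- tested as distance below 1.
distance : Expr → Expr → Expr
distance e f = (e ⊖ f) ⊕ (f ⊖ e)

distance<1⇒≡ : ∀ x y → (x ∸ y) + (y ∸ x) < 1 → x ≡ y
distance<1⇒≡ x y h = ≤-antisym
  (m∸n≡0⇒m≤n (m+n≡0⇒m≡0 (x ∸ y) (n<1⇒n≡0 h)))
  (m∸n≡0⇒m≤n (m+n≡0⇒n≡0 (x ∸ y) (n<1⇒n≡0 h)))

≡⇒distance<1 : ∀ {x y} → x ≡ y → (x ∸ y) + (y ∸ x) < 1
≡⇒distance<1 {x} refl rewrite n∸n≡0 x = s≤s z≤n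

when-true : ∀ e f p q s → ⟦ e ⟧ s < ⟦ f ⟧ s → run (when< e f p q) s ≡ run p s
when-true e f p q s h rewrite dec-true (⟦ e ⟧ s <? ⟦ f ⟧ s) h = refl

when-false : ∀ e f p q s → ¬ ⟦ e ⟧ s < ⟦ f ⟧ s → run (when< e f p q) s ≡ run q s
when-false e f p q s h rewrite dec-false (⟦ e ⟧ s <? ⟦ f ⟧ s) h = refl

update-cases : ∀ a i j v s x y →
  (i ≡ x × j ≡ y × update a i j v s a x y ≡ v) ⊎ update a i j v s a x y ≡ s a x y
update-cases a i j v s x y with i ≟ x | j ≟ y
... | yes refl | yes refl = inj₁ (refl , refl , update-same a i j v s)
... | no i≢x   | _        rewrite dec-true (a ≟ a) refl | dec-false (i ≟ x) i≢x = inj₂ refl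
... | yes refl | no j≢y
  rewrite dec-true (a ≟ a) refl | dec-true (i ≟ i) refl | dec-false (j ≟ y) j≢y = inj₂ refl

-- Array 6 holds the pointers; cells 9, 10 and 11 hold the current proposer,
-- his rival and the receiver.

record Code : Set where
  field
    proposers receivers                           : ℕ
    rank rivalRank value rivalValue known row col : Expr

module Programs (code : Code) where
  open Code code

  pointer : ℕ → Expr
  pointer c = 6 ⟪ cell c , con 0 ⟫

  advance contest rivalry leaf receiverLoop rivalLoop pass passes rounds : Prog
  advance      = put 6 (cell 9) (con 0) (pointer 9 ⊕ con 1)
  -- The nested tests form a disjunction: the rival has a permanent proposal to the receiver, or
  -- points at him.
  contest      = when< (con 0) known advance
                   (when< (distance rivalRank (pointer 10)) (con 1) advance nop)
  rivalry      = when< rivalValue value contest nop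
  leaf         = when< (distance rank (pointer 9)) (con 1) rivalry nop
  receiverLoop = for 11 receivers leaf
  rivalLoop    = for 10 proposers receiverLoop
  pass         = for 9 proposers rivalLoop
  -- The pointers sum to at most the product of the two counts, which therefore bounds the number of
  -- passes that change anything. Two nested loops perform that many passes without multiplication.
  passes       = for 8 receivers pass
  rounds       = for 7 proposers passes

  mark markLoop output whole : Prog
  mark     = when< (distance rank (pointer 9)) (con 1) (put 5 row col (con 1)) nop
  markLoop = for 11 receivers mark
  output   = for 9 proposers markLoop
  whole    = rounds ▷ output

-- Correctness of the program

record SameInput (s s′ : Store) : Set where
  constructor sameInput
  field
    same₀ : ∀ x y → s′ 0 x y ≡ s 0 x y
    same₁ : ∀ x y → s′ 1 x y ≡ s 1 x y
    same₂ : ∀ x y → s′ 2 x y ≡ s 2 x y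
    same₃ : ∀ x y → s′ 3 x y ≡ s 3 x y
    same₄ : ∀ x y → s′ 4 x y ≡ s 4 x y

open SameInput

Current : ∀ {a b} → ℕ → Store → Fin a → Fin b → Set
Current c s i j = s c 0 0 ≡ toℕ i × s 11 0 0 ≡ toℕ j

-- The expressions are evaluated in the middle of a run, so their values are prescribed in every
-- memory whose input arrays are intact. `rowOf` and `colOf` translate a pair into its output cell,
-- man first, whichever side proposes.
record Encodes (code : Code) {a b : ℕ} (market : Market a b) (s₀ : Store) : Set where
  open Code code
  open Market market

  field
    rowOf colOf : Fin a → Fin b → ℕ
    proposers≡  : s₀ 0 proposers 0 ≡ a
    receivers≡  : s₀ 0 receivers 0 ≡ b
    pointers₀   : ∀ x → s₀ 6 x 0 ≡ 0
    output₀     : ∀ x y → s₀ 5 x y ≡ 0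
    rank≡       : ∀ {s i j} → SameInput s₀ s → Current 9 s i j → ⟦ rank ⟧ s ≡ rk i j
    rivalRank≡  : ∀ {s i j} → SameInput s₀ s → Current 10 s i j → ⟦ rivalRank ⟧ s ≡ rk i j
    value≡      : ∀ {s i j} → SameInput s₀ s → Current 9 s i j → ⟦ value ⟧ s ≡ rr j i
    rivalValue≡ : ∀ {s i j} → SameInput s₀ s → Current 10 s i j → ⟦ rivalValue ⟧ s ≡ rr j i
    known⇒K     : ∀ {s i j} → SameInput s₀ s → Current 10 s i j → 0 < ⟦ known ⟧ s → K i j
    K⇒known     : ∀ {s i j} → SameInput s₀ s → Current 10 s i j → K i j → 0 < ⟦ known ⟧ s
    row≡        : ∀ {s i j} → SameInput s₀ s → Current 9 s i j → ⟦ row ⟧ s ≡ rowOf i j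
    col≡        : ∀ {s i j} → SameInput s₀ s → Current 9 s i j → ⟦ col ⟧ s ≡ colOf i j

module Execution {code : Code} {a b : ℕ} {market : Market a b} {s₀ : Store}
                 (encodes : Encodes code market s₀) where
  open Code code
  open Market market
  open Encodes encodes
  open Programs code
  open DeferredAcceptance market

  Agree : Store → Set
  Agree = SameInput s₀

  Framed : Prog → Store → Store → Set
  Framed p s s′ = ∀ a i j → Fresh a p → s′ a i j ≡ s a i j

  agree-framed : ∀ {s s′} p → {Fresh 0 p} → {Fresh 1 p} → {Fresh 2 p} → {Fresh 3 p} → {Fresh 4 p} →
                 Framed p s s′ → Agree s → Agree s′
  agree-framed p {f₀} {f₁} {f₂} {f₃} {f₄} fm (sameInput e₀ e₁ e₂ e₃ e₄) = sameInput
    (λ x y → trans (fm 0 x y f₀) (e₀ x y)) (λ x y → trans (fm 1 x y f₁) (e₁ x y))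
    (λ x y → trans (fm 2 x y f₂) (e₂ x y)) (λ x y → trans (fm 3 x y f₃) (e₃ x y))
    (λ x y → trans (fm 4 x y f₄) (e₄ x y))

  agree₀ : Agree s₀
  agree₀ = sameInput (λ _ _ → refl) (λ _ _ → refl) (λ _ _ → refl) (λ _ _ → refl) (λ _ _ → refl)

  proposerCount : ∀ {s} → Agree s → s 0 proposers 0 ≡ a
  proposerCount ag = trans (same₀ ag proposers 0) proposers≡

  receiverCount : ∀ {s} → Agree s → s 0 receivers 0 ≡ b
  receiverCount ag = trans (same₀ ag receivers 0) receivers≡

  ptrs : Store → Fin a → ℕ
  ptrs s i = s 6 (toℕ i) 0

  leaf-cases : ∀ s {i i′ j} → Agree s → s 9 0 0 ≡ toℕ i → s 10 0 0 ≡ toℕ i′ → s 11 0 0 ≡ toℕ j →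
    (Conflict (ptrs s) i i′ j × run leaf s ≡ run advance s) ⊎
    (¬ Conflict (ptrs s) i i′ j × run leaf s ≡ s)
  leaf-cases s {i} {i′} {j} ag c₉ c₁₀ c₁₁ with ⟦ distance rank (pointer 9) ⟧ s <? 1
  ... | no far = inj₂ ((λ { (conflict p _ _) →
          far (≡⇒distance<1 (trans (rank≡ ag (c₉ , c₁₁)) (trans p (cong (λ x → s 6 x 0) (sym c₉))))) })
        , when-false (distance rank (pointer 9)) (con 1) rivalry nop s far)
  ... | yes near with ⟦ rivalValue ⟧ s <? ⟦ value ⟧ s
  ...   | no ¬beaten = inj₂ ((λ { (conflict _ lt _) →
            ¬beaten (subst₂ _<_ (sym (rivalValue≡ ag (c₁₀ , c₁₁))) (sym (value≡ ag (c₉ , c₁₁))) lt) })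
          , trans (when-true (distance rank (pointer 9)) (con 1) rivalry nop s near)
                  (when-false rivalValue value contest nop s ¬beaten))
  ...   | yes lt = Sum.map
            (λ (h , eq) → conflict points beaten h , trans reduces eq)
            (λ (¬h , eq) → (λ { (conflict _ _ h) → ¬h h }) , trans reduces eq) rest
    where
    points : rk i j ≡ ptrs s i
    points = trans (sym (rank≡ ag (c₉ , c₁₁)))
      (trans (distance<1⇒≡ _ _ near) (cong (λ x → s 6 x 0) c₉))
    beaten : rr j i′ < rr j i
    beaten = subst₂ _<_ (rivalValue≡ ag (c₁₀ , c₁₁)) (value≡ ag (c₉ , c₁₁)) lt
    reduces : run leaf s ≡ run contest s
    reduces = trans (when-true (distance rank (pointer 9)) (con 1) rivalry nop s near)
                 (when-true rivalValue value contest nop s lt)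
    tail : Prog
    tail = when< (distance rivalRank (pointer 10)) (con 1) advance nop
    rest : ((K i′ j ⊎ rk i′ j ≡ ptrs s i′) × run contest s ≡ run advance s) ⊎
           (¬ (K i′ j ⊎ rk i′ j ≡ ptrs s i′) × run contest s ≡ s)
    rest with 0 <? ⟦ known ⟧ s
    ... | yes k = inj₁ (inj₁ (known⇒K ag (c₁₀ , c₁₁) k) , when-true (con 0) known advance tail s k)
    ... | no ¬k with ⟦ distance rivalRank (pointer 10) ⟧ s <? 1
    ...   | yes near′ = inj₁
      ( inj₂ (trans (sym (rivalRank≡ ag (c₁₀ , c₁₁)))
               (trans (distance<1⇒≡ _ _ near′) (cong (λ x → s 6 x 0) c₁₀)))
      , trans (when-false (con 0) known advance tail s ¬k)
              (when-true (distance rivalRank (pointer 10)) (con 1) advance nop s near′) )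
    ...   | no far′ = inj₂
      ( (λ { (inj₁ k) → ¬k (K⇒known ag (c₁₀ , c₁₁) k)
           ; (inj₂ r) → far′ (≡⇒distance<1
               (trans (rivalRank≡ ag (c₁₀ , c₁₁)) (trans r (cong (λ x → s 6 x 0) (sym c₁₀))))) })
      , trans (when-false (con 0) known advance tail s ¬k)
              (when-false (distance rivalRank (pointer 10)) (con 1) advance nop s far′) )

  advance-same : ∀ s {i} → s 9 0 0 ≡ toℕ i → ptrs (run advance s) i ≡ suc (ptrs s i)
  advance-same s {i} c₉ rewrite sym c₉ = trans (update-same 6 (s 9 0 0) 0 _ s) (+-comm _ 1)

  advance-other : ∀ s {i} → s 9 0 0 ≡ toℕ i → ∀ v → v ≢ i → ptrs (run advance s) v ≡ ptrs s v
  advance-other s {i} c₉ v v≢i with update-cases 6 (s 9 0 0) 0 (s 6 (s 9 0 0) 0 + 1) s (toℕ v) 0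
  ... | inj₁ (eq , _) = contradiction (toℕ-injective (trans (sym eq) c₉)) v≢i
  ... | inj₂ eq = eq

  -- Either some pointer has moved, which shows that there was a conflict at the start, or nothing
  -- has changed and `X` records which conflicts were found absent.
  Progress : (p p′ : Fin a → ℕ) → Set → Set
  Progress p p′ X = (sumℕ p < sumℕ p′ × ¬ Stuck p) ⊎ ((∀ v → p′ v ≡ p v) × X)

  Sweep : Store → Store → ((Fin a → ℕ) → Set) → Set₁
  Sweep s s′ C = Inv (ptrs s) → Inv (ptrs s′) × Progress (ptrs s) (ptrs s′) (C (ptrs s))

  stuck-resp : ∀ {p p′} → (∀ v → p v ≡ p′ v) → Stuck p → Stuck p′
  stuck-resp eq st i i′ j = st i i′ j ∘ conflict-resp (λ v → sym (eq v))

  sum-resp : ∀ {p p′ : Fin a → ℕ} → (∀ v → p v ≡ p′ v) → sumℕ p ≡ sumℕ p′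
  sum-resp = sum-cong-≗ +-0-commutativeMonoid

  progress-trans : ∀ {p p′ p″ X Y Z} → Progress p p′ X → Progress p′ p″ Y →
                   ((∀ v → p′ v ≡ p v) → X → Y → Z) → Progress p p″ Z
  progress-trans (inj₁ (lt , ¬st)) (inj₁ (lt′ , _)) _ = inj₁ (<-trans lt lt′ , ¬st)
  progress-trans {p} (inj₁ (lt , ¬st)) (inj₂ (eq , _)) _ =
    inj₁ (subst (sumℕ p <_) (sym (sum-resp eq)) lt , ¬st)
  progress-trans {p″ = p″} (inj₂ (eq , _)) (inj₁ (lt , ¬st)) _ =
    inj₁ (subst (_< sumℕ p″) (sum-resp eq) lt , ¬st ∘ stuck-resp (λ v → sym (eq v)))
  progress-trans (inj₂ (eq , x)) (inj₂ (eq′ , y)) f =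
    inj₂ ((λ v → trans (eq′ v) (eq v)) , f eq x y)

  leaf-sweep : ∀ s {i i′ j} → Agree s → s 9 0 0 ≡ toℕ i → s 10 0 0 ≡ toℕ i′ → s 11 0 0 ≡ toℕ j →
               Sweep s (run leaf s) (λ p → ¬ Conflict p i i′ j)
  leaf-sweep s {i} ag c₉ c₁₀ c₁₁ inv with leaf-cases s ag c₉ c₁₀ c₁₁
  ... | inj₂ (¬cf , eq) rewrite eq = inv , inj₂ ((λ _ → refl) , ¬cf)
  ... | inj₁ (cf , eq) rewrite eq =
    Inv-step cf up same inv ,
    inj₁ (sum-mono-< i grows (≤-reflexive (sym up)) , λ st → st _ _ _ cf)
    where
    up = advance-same s {i} c₉
    same = advance-other s {i} c₉
    grows : ∀ v → ptrs s v ≤ ptrs (run advance s) v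
    grows v with v ≟ᶠ i
    ... | yes refl = ≤-trans (n≤1+n _) (≤-reflexive (sym up))
    ... | no v≢i   = ≤-reflexive (sym (same v v≢i))

  -- Iteration `x` checks `C x`. If no iteration moves a pointer, all these checks were made at the
  -- same pointers, so they hold together. `resp` transports a check along pointwise equality of
  -- pointers.
  for-sweep : ∀ c b′ p s N (C : Fin N → (Fin a → ℕ) → Set) → WF (for c b′ p) → s 0 b′ 0 ≡ N →
    (∀ v s → ptrs (update c 0 0 v s) ≡ ptrs s) →
    (∀ x {p p′} → (∀ v → p v ≡ p′ v) → C x p → C x p′) →
    (∀ x s′ → s′ c 0 0 ≡ toℕ x → Framed (for c b′ p) s s′ → Sweep s′ (run p s′) (C x)) →
    Sweep s (run (for c b′ p) s) (λ p → ∀ x → C x p)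
  for-sweep c b′ p s N C wf N≡ keep resp body inv =
    let inv′ , prog = for-induction c b′ p s N (λ k s′ → I k (ptrs s′)) wf N≡ base step in
    inv′ , Sum.map₂ (λ (eq , h) → eq , λ x → h x (toℕ<n x)) prog
    where
    I : ℕ → (Fin a → ℕ) → Set₁
    I k p = Inv p × Progress (ptrs s) p (∀ x → toℕ x < k → C x (ptrs s))

    base : I 0 (ptrs (update c 0 0 0 s))
    base = subst (I 0) (sym (keep 0 s)) (inv , inj₂ ((λ _ → refl) , λ _ ()))

    step : ∀ x s′ → s′ c 0 0 ≡ toℕ x → Framed (for c b′ p) s s′ →
           I (toℕ x) (ptrs s′) → I (suc (toℕ x)) (ptrs (bump c (run p s′)))
    step x s′ c≡ fm (inv′ , prog) =
      let inv″ , prog′ = body x s′ c≡ fm inv′ in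
      subst (I _) (sym (keep _ (run p s′)))
        (inv″ , progress-trans prog prog′ (λ eq h hx → below-suc x h (resp x eq hx)))

  pass-sweep : ∀ s → Agree s → Sweep s (run pass s) Stuck
  pass-sweep s ag =
    for-sweep 9 proposers rivalLoop s a (λ i p → ∀ i′ j → ¬ Conflict p i i′ j) _
      (proposerCount ag) (λ _ _ → refl)
      (λ i eq h i′ j → h i′ j ∘ conflict-resp (λ v → sym (eq v)))
      λ i s₁ c₁ fm₁ → let ag₁ = agree-framed pass fm₁ ag in
    for-sweep 10 proposers receiverLoop s₁ a (λ i′ p → ∀ j → ¬ Conflict p i i′ j) _
      (proposerCount ag₁) (λ _ _ → refl)
      (λ i′ eq h j → h j ∘ conflict-resp (λ v → sym (eq v)))
      λ i′ s₂ c₂ fm₂ → let ag₂ = agree-framed rivalLoop fm₂ ag₁ in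
    for-sweep 11 receivers leaf s₂ b (λ j p → ¬ Conflict p i i′ j) _
      (receiverCount ag₂) (λ _ _ → refl)
      (λ j eq h → h ∘ conflict-resp (λ v → sym (eq v)))
      λ j s₃ c₃ fm₃ →
    leaf-sweep s₃ (agree-framed receiverLoop fm₃ ag₂)
      (trans (fm₃ 9 0 0 _) (trans (fm₂ 9 0 0 _) c₁)) (trans (fm₃ 10 0 0 _) c₂) c₃

  -- `k` counts completed passes: as long as conflicts remain, each pass raises the sum of the
  -- pointers by at least one.
  Reached : ℕ → Store → Set₁
  Reached k s = Inv (ptrs s) × (Stuck (ptrs s) ⊎ k ≤ sumℕ (ptrs s))

  pass-reached : ∀ {k} s → Agree s → Reached k s → Reached (suc k) (run pass s)
  pass-reached s ag (inv , done) with pass-sweep s ag inv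
  ... | inv′ , inj₂ (eq , st) = inv′ , inj₁ (stuck-resp (λ v → sym (eq v)) st)
  ... | inv′ , inj₁ (lt , ¬st) with done
  ...   | inj₁ st = contradiction st ¬st
  ...   | inj₂ le = inv′ , inj₂ (≤-<-trans le lt)

  rounds-reached : Reached (a * b) (run rounds s₀)
  rounds-reached =
    for-induction 7 proposers passes s₀ a (λ k → Reached (k * b)) _ proposers≡
      (Inv-zero (λ i → pointers₀ (toℕ i)) , inj₂ z≤n)
      λ i s₁ c₁ fm₁ reached →
    let ag₁ = agree-framed rounds fm₁ agree₀ in
    subst (λ k → Reached k (run passes s₁)) (+-comm (toℕ i * b) b)
      (for-induction 8 receivers pass s₁ b (λ k → Reached (toℕ i * b + k)) _
        (receiverCount ag₁)
        (subst (λ k → Reached k s₁) (sym (+-identityʳ (toℕ i * b))) reached)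
        λ j s₂ c₂ fm₂ reached′ →
      subst (λ k → Reached k (run pass s₂)) (sym (+-suc (toℕ i * b) (toℕ j)))
        (pass-reached s₂ (agree-framed passes fm₂ ag₁) reached′))

  -- A conflict needs a pointer below b, so none is left once all are at b.
  reached⇒stuck : ∀ s → Reached (a * b) s → Stuck (ptrs s)
  reached⇒stuck s (inv , inj₁ st) = st
  reached⇒stuck s (inv , inj₂ le) i i′ j cf = <⇒≱
    (subst (sumℕ (ptrs s) <_) (sum-const a b)
      (sum-mono-< i (Inv.bounded inv)
        (subst (_< b) (Conflict.points cf) (rk-bounded i j))))
    le

  Sound : (Fin a → ℕ) → Store → Set
  Sound q s = ∀ x y → s 5 x y ≡ 0 ⊎
    (s 5 x y ≡ 1 × ∃[ i ] ∃[ j ] rk i j ≡ q i × rowOf i j ≡ x × colOf i j ≡ y)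

  Marked : Store → Fin a → Fin b → Set
  Marked s i j = s 5 (rowOf i j) (colOf i j) ≡ 1

  mark-correct : ∀ s {i j} → Agree s → s 9 0 0 ≡ toℕ i → s 11 0 0 ≡ toℕ j →
    Sound (ptrs s) s →
    Sound (ptrs s) (run mark s) ×
    (∀ i′ j′ → Marked s i′ j′ → Marked (run mark s) i′ j′) ×
    (rk i j ≡ ptrs s i → Marked (run mark s) i j)
  mark-correct s {i} {j} ag c₉ c₁₁ sound with ⟦ distance rank (pointer 9) ⟧ s <? 1
  ... | no far
    rewrite when-false (distance rank (pointer 9)) (con 1) (put 5 row col (con 1)) nop s far =
    sound , (λ _ _ → id) , λ p → contradiction
      (≡⇒distance<1 (trans (rank≡ ag (c₉ , c₁₁)) (trans p (cong (λ x → s 6 x 0) (sym c₉))))) far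
  ... | yes near
    rewrite when-true (distance rank (pointer 9)) (con 1) (put 5 row col (con 1)) nop s near
          | row≡ {s} {i} {j} ag (c₉ , c₁₁) | col≡ {s} {i} {j} ag (c₉ , c₁₁) =
    sound′ , keep , λ _ → update-same 5 (rowOf i j) (colOf i j) 1 s
    where
    s′ = update 5 (rowOf i j) (colOf i j) 1 s
    sound′ : Sound (ptrs s) s′
    sound′ x y with update-cases 5 (rowOf i j) (colOf i j) 1 s x y
    ... | inj₁ (ex , ey , eq) = inj₂ (eq , i , j , points , ex , ey)
      where points = trans (sym (rank≡ ag (c₉ , c₁₁)))
                       (trans (distance<1⇒≡ _ _ near) (cong (λ x → s 6 x 0) c₉))
    ... | inj₂ eq = Sum.map (trans eq) (λ (one , h) → trans eq one , h) (sound x y)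
    keep : ∀ i′ j′ → Marked s i′ j′ → Marked s′ i′ j′
    keep i′ j′ h with update-cases 5 (rowOf i j) (colOf i j) 1 s (rowOf i′ j′) (colOf i′ j′)
    ... | inj₁ (_ , _ , eq) = eq
    ... | inj₂ eq = trans eq h

  Sound-resp : ∀ {q q′ s} → (∀ v → q v ≡ q′ v) → Sound q s → Sound q′ s
  Sound-resp eq sound x y =
    Sum.map₂ (λ (one , i , j , p , h) → one , i , j , trans p (eq i) , h) (sound x y)

  output-correct : ∀ s → Agree s → (∀ x y → s 5 x y ≡ 0) →
    Sound (ptrs s) (run output s) × (∀ i j → rk i j ≡ ptrs s i → Marked (run output s) i j)
  output-correct s ag blank =
    let sound , marked =
          for-induction 9 proposers markLoop s a Outer _
            (proposerCount ag)
            ((λ x y → inj₁ (blank x y)) , λ _ ()) outer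
    in sound , λ i j → marked i (toℕ<n i) j
    where
    Hit : Store → Fin a → Set
    Hit s′ i = ∀ j → rk i j ≡ ptrs s i → Marked s′ i j

    Outer : ℕ → Store → Set
    Outer k s′ = Sound (ptrs s) s′ × (∀ i → toℕ i < k → Hit s′ i)

    outer : ∀ i s₁ → s₁ 9 0 0 ≡ toℕ i → Framed output s s₁ →
            Outer (toℕ i) s₁ → Outer (suc (toℕ i)) (bump 9 (run markLoop s₁))
    outer i s₁ c₁ fm₁ (sound , hits) =
      let sound′ , hits′ , row =
            for-induction 11 receivers mark s₁ b Inner _
              (receiverCount ag₁)
              (sound , hits , λ _ ()) inner
      in sound′ , below-suc i hits′ (λ j → row j (toℕ<n j))
      where
      ag₁ = agree-framed output fm₁ ag

      Inner : ℕ → Store → Set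
      Inner k s′ = Sound (ptrs s) s′ × (∀ i′ → toℕ i′ < toℕ i → Hit s′ i′)
                 × (∀ j → toℕ j < k → rk i j ≡ ptrs s i → Marked s′ i j)

      inner : ∀ j s₂ → s₂ 11 0 0 ≡ toℕ j → Framed markLoop s₁ s₂ →
              Inner (toℕ j) s₂ → Inner (suc (toℕ j)) (bump 11 (run mark s₂))
      inner j s₂ c₂ fm₂ (sound₂ , hits₂ , row₂) =
        -- Marking leaves array 6 alone, so the pointers are still those from the start of the
        -- output phase.
        let same = λ v → trans (fm₂ 6 (toℕ v) 0 _) (fm₁ 6 (toℕ v) 0 _)
            sound₃ , keep , new =
              mark-correct s₂ {i} {j} (agree-framed markLoop fm₂ ag₁) (trans (fm₂ 9 0 0 _) c₁) c₂
                (Sound-resp {s = s₂} (λ v → sym (same v)) sound₂)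
        in Sound-resp {s = run mark s₂} same sound₃
         , (λ i′ lt j′ p → keep i′ j′ (hits₂ i′ lt j′ p))
         , below-suc j (λ j′ lt p → keep i j′ (row₂ j′ lt p)) (λ p → new (trans p (sym (same i))))

  -- Sealed: what follows uses the outcome only through these facts and never unfolds the run.
  abstract
    final : Store
    final = run whole s₀

    final-run : run whole s₀ ≡ final
    final-run = refl

    result : Fin a → ℕ
    result = ptrs (run rounds s₀)

    result-Inv : Inv result
    result-Inv = proj₁ rounds-reached

    result-Stuck : Stuck result
    result-Stuck = reached⇒stuck (run rounds s₀) rounds-reached

    final-correct : Sound result final × (∀ i j → rk i j ≡ result i → Marked final i j)
    final-correct = output-correct (run rounds s₀)
      (agree-framed rounds (λ a i j → run-fresh {a} rounds s₀ i j) agree₀)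
      (λ x y → trans (run-fresh rounds s₀ x y _) (output₀ x y))

  open Outcome result-Inv result-Stuck public

-- Finite sets, ranks and the input tables

comprehension : ∀ {n} {Q : Fin n → Set} → (∀ x → Dec (Q x)) → Subset n
comprehension Q? = tabulate (does ∘ Q?)

∈-comprehension⁺ : ∀ {n} {Q : Fin n → Set} (Q? : ∀ x → Dec (Q x)) {x} → Q x → x ∈ comprehension Q?
∈-comprehension⁺ Q? {x} h =
  lookup⇒[]= x _ (trans (lookup∘tabulate (does ∘ Q?) x) (dec-true (Q? x) h))

∈-comprehension⁻ : ∀ {n} {Q : Fin n → Set} (Q? : ∀ x → Dec (Q x)) {x} → x ∈ comprehension Q? → Q x
∈-comprehension⁻ Q? {x} h with Q? x | trans (sym (lookup∘tabulate (does ∘ Q?) x)) ([]=⇒lookup h)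
... | yes q | _ = q

module Rank {n} {_≻_ : Rel (Fin n) 0ℓ} (order : IsStrictTotalOrder _≡_ _≻_) (W : Subset n) where
  open IsStrictTotalOrder order renaming (_<?_ to _≻?_; trans to ≻-trans; irrefl to ≻-irrefl)

  better : Fin n → Subset n
  better w = W ∩ comprehension (_≻? w)

  rank : Fin n → ℕ
  rank w = ∣ better w ∣

  -- Whatever is better than `w` is better than `w′` by transitivity, and `w` itself makes the
  -- inclusion proper.
  rank-mono : ∀ {w w′} → w ∈ W → w ≻ w′ → rank w < rank w′
  rank-mono {w} {w′} w∈W w≻w′ = p⊂q⇒∣p∣<∣q∣
    ( (λ h → let v∈W , h′ = x∈p∩q⁻ W _ h in
             x∈p∩q⁺ (v∈W , ∈-comprehension⁺ (_≻? w′) (≻-trans (∈-comprehension⁻ (_≻? w) h′) w≻w′)))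
    , w , x∈p∩q⁺ (w∈W , ∈-comprehension⁺ (_≻? w′) w≻w′)
    , λ h → ≻-irrefl refl (∈-comprehension⁻ (_≻? w) (proj₂ (x∈p∩q⁻ W _ h))) )

  rank-bounded : ∀ {w} → w ∈ W → rank w < ∣ W ∣
  rank-bounded {w} w∈W = p⊂q⇒∣p∣<∣q∣
    ( (λ h → proj₁ (x∈p∩q⁻ W _ h))
    , w , w∈W , λ h → ≻-irrefl refl (∈-comprehension⁻ (_≻? w) (proj₂ (x∈p∩q⁻ W _ h))) )

  rank-reflects : ∀ {w w′} → w′ ∈ W → rank w < rank w′ → w ≻ w′
  rank-reflects {w} {w′} w′∈W lt with compare w w′
  ... | tri< h _ _    = h
  ... | tri≈ _ refl _ = contradiction lt (<-irrefl refl)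
  ... | tri> _ _ h    = contradiction (rank-mono w′∈W h) (<-asym lt)

  rank-injective : ∀ {w w′} → w ∈ W → w′ ∈ W → rank w ≡ rank w′ → w ≡ w′
  rank-injective {w} {w′} w∈W w′∈W eq with compare w w′
  ... | tri< h _ _ = contradiction (rank-mono w∈W h) (<-irrefl eq)
  ... | tri≈ _ h _ = h
  ... | tri> _ _ h = contradiction (rank-mono w′∈W h) (<-irrefl (sym eq))

-- The increasing enumeration, which is the order in which array 1 lists the names.
enum : ∀ {n} (W : Subset n) → Fin ∣ W ∣ → Fin n
enum (inside ∷ W)  zero    = zero
enum (inside ∷ W)  (suc j) = suc (enum W j)
enum (outside ∷ W) j       = suc (enum W j)

enum∈ : ∀ {n} (W : Subset n) j → enum W j ∈ W
enum∈ (inside ∷ W)  zero    = here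
enum∈ (inside ∷ W)  (suc j) = there (enum∈ W j)
enum∈ (outside ∷ W) j       = there (enum∈ W j)

enum-injective : ∀ {n} (W : Subset n) {i j} → enum W i ≡ enum W j → i ≡ j
enum-injective (inside ∷ W)  {zero}  {zero}  eq = refl
enum-injective (inside ∷ W)  {suc i} {suc j} eq = cong suc (enum-injective W (suc-injective eq))
enum-injective (outside ∷ W) eq = enum-injective W (suc-injective eq)

enum-onto : ∀ {n} (W : Subset n) {w} → w ∈ W → ∃[ j ] enum W j ≡ w
enum-onto (inside ∷ W)  here = zero , refl
enum-onto (inside ∷ W)  (there h) with j , refl ← enum-onto W h = suc j , refl
enum-onto (outside ∷ W) (there h) with j , refl ← enum-onto W h = j , refl

column-women : ∀ {n} (W : Subset n) j → column (women W) (toℕ j) 0 ≡ toℕ (enum W j)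
column-women {n} W j = go W id (λ _ → refl) j
  where
  -- Generalized to a tail of the list of all women, tabulated by `f`, with `V` the corresponding
  -- tail of `W`.
  go : ∀ {k} (V : Subset k) (f : Fin k → Fin n) → (∀ i → does (f i ∈? W) ≡ does (i ∈? V)) →
       ∀ j → column (List.map toℕ (filter (_∈? W) (List.tabulate f))) (toℕ j) 0 ≡ toℕ (f (enum V j))
  go (inside ∷ V)  f eq zero    with does (f zero ∈? W) | eq zero
  ... | true | _ = refl
  go (inside ∷ V)  f eq (suc j) with does (f zero ∈? W) | eq zero
  ... | true | _ = go V (f ∘ suc) (eq ∘ suc) j
  go (outside ∷ V) f eq j       with does (f zero ∈? W) | eq zero
  ... | false | _ = go V (f ∘ suc) (eq ∘ suc) j

table-toℕ : ∀ {a b} (f : Fin a → Fin b → ℕ) i j → table f (toℕ i) (toℕ j) ≡ f i j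
table-toℕ {a} {b} f i j with toℕ i <? a | toℕ j <? b
... | yes p | yes q = cong₂ f (fromℕ<-toℕ i p) (fromℕ<-toℕ j q)
... | no p  | _     = contradiction (toℕ<n i) p
... | yes _ | no q  = contradiction (toℕ<n j) q

-- A cell holding 0 cannot stand for a pair of `M`, as it would then hold 1.
outputs : ∀ {m n} {s} {M : PairSet m n} →
  (∀ x y → s 5 x y ≡ 0 ⊎ (s 5 x y ≡ 1 × ∃[ u ] ∃[ w ] w ∈ M u × toℕ u ≡ x × toℕ w ≡ y)) →
  (∀ {u w} → w ∈ M u → s 5 (toℕ u) (toℕ w) ≡ 1) →
  Outputs s M
outputs {m} {n} {s} {M} sound complete x y with sound x y
... | inj₂ (one , u , w , h , refl , refl) =
  trans one (sym (trans (table-toℕ (indicator M) u w)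
    (cong (if_then 1 else 0) (dec-true (w ∈? M u) h))))
... | inj₁ zero≡ with x <? m | y <? n
...   | no _    | _     = zero≡
...   | yes _   | no _  = zero≡
...   | yes x<m | yes y<n = trans zero≡ (sym (cong (if_then 1 else 0) (dec-false (w ∈? M u) absent)))
  where
  u = fromℕ< x<m
  w = fromℕ< y<n
  absent : w ∉ M u
  absent h with () ← trans (sym zero≡)
    (subst₂ (λ x y → s 5 x y ≡ 1) (toℕ-fromℕ< x<m) (toℕ-fromℕ< y<n) (complete h))

module _ {m n} (P : Preferences m n) (W : Subset n) where
  open Preferences P

  manRank-def : ∀ u {w} → w ∈ W → manRank P W u w ≡ Rank.rank (manOrder u) W w
  manRank-def u {w} w∈W rewrite dec-true (w ∈? W) w∈W = refl

  womanRank-def : ∀ {w} → w ∈ W → ∀ u → womanRank P W w u ≡ Rank.rank (womanOrder w) ⊤ u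
  womanRank-def {w} w∈W u rewrite dec-true (w ∈? W) w∈W = 
    cong ∣_∣ (sym (∩-identityˡ (comprehension (λ u′ → IsStrictTotalOrder._<?_ (womanOrder w) u′ u))))

  manRank-mono : ∀ u {w w′} → w ∈ W → w′ ∈ W → ManPrefers u w w′ → manRank P W u w < manRank P W u w′
  manRank-mono u w∈ w′∈ h rewrite manRank-def u w∈ | manRank-def u w′∈ =
    Rank.rank-mono (manOrder u) W w∈ h

  manRank-reflects : ∀ u {w w′} → w ∈ W → w′ ∈ W → manRank P W u w < manRank P W u w′ → ManPrefers u w w′
  manRank-reflects u w∈ w′∈ h rewrite manRank-def u w∈ | manRank-def u w′∈ =
    Rank.rank-reflects (manOrder u) W w′∈ h

  manRank-injective : ∀ u {w w′} → w ∈ W → w′ ∈ W → manRank P W u w ≡ manRank P W u w′ → w ≡ w′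
  manRank-injective u w∈ w′∈ h rewrite manRank-def u w∈ | manRank-def u w′∈ =
    Rank.rank-injective (manOrder u) W w∈ w′∈ h

  manRank-bounded : ∀ u {w} → w ∈ W → manRank P W u w < ∣ W ∣
  manRank-bounded u w∈ rewrite manRank-def u w∈ = Rank.rank-bounded (manOrder u) W w∈

  womanRank-mono : ∀ {w} → w ∈ W → ∀ {u u′} → WomanPrefers w u u′ → womanRank P W w u < womanRank P W w u′
  womanRank-mono {w} w∈ {u} {u′} h rewrite womanRank-def w∈ u | womanRank-def w∈ u′ =
    Rank.rank-mono (womanOrder w) ⊤ ∈⊤ h

  womanRank-reflects : ∀ {w} → w ∈ W → ∀ {u u′} → womanRank P W w u < womanRank P W w u′ → WomanPrefers w u u′
  womanRank-reflects {w} w∈ {u} {u′} h rewrite womanRank-def w∈ u | womanRank-def w∈ u′ =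
    Rank.rank-reflects (womanOrder w) ⊤ ∈⊤ h

  womanRank-injective : ∀ {w} → w ∈ W → ∀ {u u′} → womanRank P W w u ≡ womanRank P W w u′ → u ≡ u′
  womanRank-injective {w} w∈ {u} {u′} h rewrite womanRank-def w∈ u | womanRank-def w∈ u′ =
    Rank.rank-injective (womanOrder w) ⊤ ∈⊤ ∈⊤ h

  womanRank-bounded : ∀ {w} → w ∈ W → ∀ u → womanRank P W w u < m
  womanRank-bounded {w} w∈ u rewrite womanRank-def w∈ u =
    subst (Rank.rank (womanOrder w) ⊤ u <_) (∣⊤∣≡n m) (Rank.rank-bounded (womanOrder w) ⊤ ∈⊤)

  input-bounded : ∀ K → Bounded (size m W) (input P W K)
  input-bounded K zero          = m≤m+n m ∣ W ∣
  input-bounded K (suc zero)    = m≤n+m ∣ W ∣ m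
  input-bounded K (suc (suc _)) = z≤n

computes : ∀ {m n k N s} (M : PairSet m n) p → WF p → Bounded N s → Outputs (run p s) M →
           cost p * 2 ^ depth p ≤ k → depth p ≤ k → Computes (compile p) s M (poly k N)
computes {k = k} {N} {s} M p wf B out ck dk =
  let t , d , t≤ = compile-correct N p s wf B in
  run p s , t , d , out , poly-bound (cost p) (depth p) k N (≤-trans t≤ (time≤ p N)) ck dk

-- The programs of the two stages

code₁ code₂ : Code
code₁ = record
  -- Men propose. These two numbers select cells of array 0, with the sizes of `U` and `W`. Women
  -- are counted by position, and array 1 translates positions into names.
  { proposers  = 0
  ; receivers  = 1
  ; rank       = 2 ⟪ cell 9 , name ⟫
  ; rivalRank  = 2 ⟪ cell 10 , name ⟫
  ; value      = 3 ⟪ name , cell 9 ⟫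
  ; rivalValue = 3 ⟪ name , cell 10 ⟫
  ; known      = con 0
  ; row        = cell 9
  ; col        = name
  }
  where
  name : Expr
  name = 1 ⟪ cell 11 , con 0 ⟫
code₂ = record
  -- Women propose. All of them are present, so position and name coincide. Array 4, indexed by man
  -- and woman, holds the permanent proposals.
  { proposers  = 1
  ; receivers  = 0
  ; rank       = 3 ⟪ cell 9 , cell 11 ⟫
  ; rivalRank  = 3 ⟪ cell 10 , cell 11 ⟫
  ; value      = 2 ⟪ cell 11 , cell 9 ⟫
  ; rivalValue = 2 ⟪ cell 11 , cell 10 ⟫
  ; known      = 4 ⟪ cell 11 , cell 10 ⟫
  ; row        = cell 11
  ; col        = cell 9
  }

program₁ program₂ : Prog
program₁ = Programs.whole code₁
program₂ = Programs.whole code₂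

module Reading {m n} (P : Preferences m n) (W : Subset n) (K : PairSet m n) where

  s₀ : Store
  s₀ = input P W K

  name≡ : ∀ {s j} → SameInput s₀ s → s 11 0 0 ≡ toℕ j → s 1 (s 11 0 0) 0 ≡ toℕ (enum W j)
  name≡ {s} {j} same eq = trans (same₁ same (s 11 0 0) 0)
    (trans (cong (λ x → column (women W) x 0) eq) (column-women W j))

  manTable≡ : ∀ {s x y u w} → SameInput s₀ s → x ≡ toℕ u → y ≡ toℕ w → s 2 x y ≡ manRank P W u w
  manTable≡ {s} {u = u} {w} same refl refl =
    trans (same₂ same (toℕ u) (toℕ w)) (table-toℕ (manRank P W) u w)

  womanTable≡ : ∀ {s x y u w} → SameInput s₀ s → x ≡ toℕ w → y ≡ toℕ u → s 3 x y ≡ womanRank P W w u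
  womanTable≡ {s} {u = u} {w} same refl refl =
    trans (same₃ same (toℕ w) (toℕ u)) (table-toℕ (womanRank P W) w u)

  pairTable≡ : ∀ {s x y u w} → SameInput s₀ s → x ≡ toℕ u → y ≡ toℕ w → s 4 x y ≡ indicator K u w
  pairTable≡ {s} {u = u} {w} same refl refl =
    trans (same₄ same (toℕ u) (toℕ w)) (table-toℕ (indicator K) u w)

-- First stage: the men-optimal stable matching

module Stage₁ {m n} (P : Preferences m n) (W : Subset n) where
  open Stability P
  open Reading P W ∅

  rk : Fin m → Fin ∣ W ∣ → ℕ
  rk u j = manRank P W u (enum W j)

  rr : Fin ∣ W ∣ → Fin m → ℕ
  rr j u = womanRank P W (enum W j) u

  market : Market m ∣ W ∣
  market = record
    { rk           = rk
    ; rr           = rr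
    ; K            = λ _ _ → Empty
    ; rk-injective = λ {u} eq →
        enum-injective W (manRank-injective P W u (enum∈ W _) (enum∈ W _) eq)
    ; rk-bounded   = λ u j → manRank-bounded P W u (enum∈ W j)
    ; rr-injective = λ {j} → womanRank-injective P W (enum∈ W j)
    }

  encodes : Encodes code₁ market s₀
  encodes = record
    { rowOf       = λ u j → toℕ u
    ; colOf       = λ u j → toℕ (enum W j)
    ; proposers≡  = refl
    ; receivers≡  = refl
    ; pointers₀   = λ _ → refl
    ; output₀     = λ _ _ → refl
    ; rank≡       = λ same (e , e′) → manTable≡ same e (name≡ same e′)
    ; rivalRank≡  = λ same (e , e′) → manTable≡ same e (name≡ same e′)
    ; value≡      = λ same (e , e′) → womanTable≡ same (name≡ same e′) e
    ; rivalValue≡ = λ same (e , e′) → womanTable≡ same (name≡ same e′) e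
    ; known⇒K     = λ _ _ ()
    ; K⇒known     = λ _ _ ()
    ; row≡        = λ _ (e , _) → e
    ; col≡        = λ same (_ , e′) → name≡ same e′
    }

  open DeferredAcceptance market
  open Execution encodes

  matched? : ∀ u w → Dec (w ∈ W × manRank P W u w ≡ result u)
  matched? u w = (w ∈? W) ×-dec (manRank P W u w ≟ result u)

  matching : PairSet m n
  matching u = comprehension (matched? u)

  ∈matching⁻ : ∀ {u w} → w ∈ matching u → ∃[ j ] enum W j ≡ w × Points u j
  ∈matching⁻ {u} h with w∈W , eq ← ∈-comprehension⁻ (matched? u) h
                   with j , refl ← enum-onto W w∈W = j , refl , eq

  ∈matching⁺ : ∀ {u j} → Points u j → enum W j ∈ matching u
  ∈matching⁺ {u} {j} h = ∈-comprehension⁺ (matched? u) (enum∈ W j , h)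

  matching-isMatching : IsMatching W matching
  matching-isMatching = record
    { within       = λ {u} h → proj₁ (∈-comprehension⁻ (matched? u) h)
    ; man-unique   = man
    ; woman-unique = woman
    }
    where
    man : ∀ {u w w′} → w ∈ matching u → w′ ∈ matching u → w ≡ w′
    man h h′ with j , refl , p ← ∈matching⁻ h | j′ , refl , p′ ← ∈matching⁻ h′ =
      cong (enum W) (proposer-unique p p′)
    woman : ∀ {u u′ w} → w ∈ matching u → w ∈ matching u′ → u ≡ u′
    woman h h′ with j , refl , p ← ∈matching⁻ h | j′ , eq , p′ ← ∈matching⁻ h′
               with refl ← enum-injective W eq = receiver-unique p p′

  matching-calm : ∀ u w → w ∈ W → Calm matching u w
  matching-calm u w w∈W with j , refl ← enum-onto W w∈W with outcome-calm u j
  ... | inj₁ p = inj₁ (∈matching⁺ p)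
  ... | inj₂ (inj₁ (j′ , p , lt)) =
    inj₂ (inj₁ (enum W j′ , ∈matching⁺ p , manRank-reflects P W u (enum∈ W j′) w∈W lt))
  ... | inj₂ (inj₂ (u′ , inj₂ p , lt)) =
    inj₂ (inj₂ (u′ , ∈matching⁺ p , womanRank-reflects P W w∈W lt))

  -- Without permanent proposals every stable matching is a candidate, so proposer-optimality
  -- becomes men-optimality.
  candidate : ∀ {M} → IsStable P W M → Candidate (λ u j → enum W j ∈ M u)
  candidate {M} st = record
    { unique   = IsMatching.woman-unique (IsStable.isMatching st)
    ; calm     = calm
    ; respects = λ ()
    }
    where
    calm : ∀ u j → enum W j ∈ M u
         ⊎ (∃[ j′ ] enum W j′ ∈ M u × rk u j′ < rk u j)
         ⊎ (∃[ u′ ] enum W j ∈ M u′ × rr j u′ < rr j u)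
    calm u j with stable⇒calm st u (enum∈ W j)
    ... | inj₁ h = inj₁ h
    ... | inj₂ (inj₂ (u′ , h , h′)) = inj₂ (inj₂ (u′ , h , womanRank-mono P W (enum∈ W j) h′))
    ... | inj₂ (inj₁ (w′ , h , h′))
      with w′∈W ← IsMatching.within (IsStable.isMatching st) h
      with j′ , refl ← enum-onto W w′∈W =
      inj₂ (inj₁ (j′ , h , manRank-mono P W u w′∈W (enum∈ W j) h′))

  menOptimal : IsMenOptimal P W matching
  menOptimal = record
    { isStable = calm⇒stable matching-isMatching matching-calm
    ; best     = best
    }
    where
    best : ∀ u w → StablePartner P W u w → ∃[ w′ ] w′ ∈ matching u × w′ ≽⟨ u ⟩ w
    best u w (M , st , h)
      with w∈W ← IsMatching.within (IsStable.isMatching st) h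
      with j , refl ← enum-onto W w∈W with outcome-best (candidate st) h
    ... | inj₁ p = enum W j , ∈matching⁺ p , inj₁ refl
    ... | inj₂ (j′ , p , lt) =
      enum W j′ , ∈matching⁺ p , inj₂ (manRank-reflects P W u (enum∈ W j′) w∈W lt)

  matching-output : Outputs (run program₁ s₀) matching
  matching-output = subst (λ s → Outputs s matching) (sym final-run) (outputs {s = final} {matching}
    (λ x y → Sum.map₂ (λ (one , u , j , p , ex , ey) → one , u , enum W j , ∈matching⁺ p , ex , ey)
               (proj₁ final-correct x y))
    complete)
    where
    complete : ∀ {u w} → w ∈ matching u → final 5 (toℕ u) (toℕ w) ≡ 1
    complete {u} h with j , refl , p ← ∈matching⁻ h = proj₂ final-correct u j p

-- Second stage: a stable matching of maximum weight

module Stage₂ {m n} (P : Preferences m n) {W₁ : Subset n} {M₁ : PairSet m n}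
              (st₁ : IsStable P W₁ M₁) where
  open Stability P
  open Reading P ⊤ M₁

  rk : Fin n → Fin m → ℕ
  rk w u = womanRank P ⊤ w u

  rr : Fin m → Fin n → ℕ
  rr u w = manRank P ⊤ u w

  indicator>0⇒∈ : ∀ {u w} → 0 < indicator M₁ u w → w ∈ M₁ u
  indicator>0⇒∈ {u} {w} h with w ∈? M₁ u
  ... | yes w∈ = w∈

  ∈⇒indicator>0 : ∀ {u w} → w ∈ M₁ u → 0 < indicator M₁ u w
  ∈⇒indicator>0 {u} {w} h with w ∈? M₁ u
  ... | yes _ = s≤s z≤n
  ... | no w∉ = contradiction h w∉

  market : Market n m
  market = record
    { rk           = rk
    ; rr           = rr
    ; K            = λ w u → w ∈ M₁ u
    ; rk-injective = λ {w} → womanRank-injective P ⊤ {w} ∈⊤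
    ; rk-bounded   = λ w → womanRank-bounded P ⊤ {w} ∈⊤
    ; rr-injective = λ {u} → manRank-injective P ⊤ u ∈⊤ ∈⊤
    }

  encodes : Encodes code₂ market s₀
  encodes = record
    { rowOf       = λ w u → toℕ u
    ; colOf       = λ w u → toℕ w
    ; proposers≡  = ∣⊤∣≡n n
    ; receivers≡  = refl
    ; pointers₀   = λ _ → refl
    ; output₀     = λ _ _ → refl
    ; rank≡       = λ same (e , e′) → womanTable≡ same e e′
    ; rivalRank≡  = λ same (e , e′) → womanTable≡ same e e′
    ; value≡      = λ same (e , e′) → manTable≡ same e′ e
    ; rivalValue≡ = λ same (e , e′) → manTable≡ same e′ e
    ; known⇒K     = λ same (e , e′) h → indicator>0⇒∈ (subst (0 <_) (pairTable≡ same e′ e) h)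
    ; K⇒known     = λ same (e , e′) h → subst (0 <_) (sym (pairTable≡ same e′ e)) (∈⇒indicator>0 h)
    ; row≡        = λ _ (_ , e′) → e′
    ; col≡        = λ _ (e , _) → e
    }

  open DeferredAcceptance market
  open Execution encodes

  matched? : ∀ u w → Dec (Points w u)
  matched? u w = rk w u ≟ result w

  matching : PairSet m n
  matching u = comprehension (matched? u)

  ∈matching⁻ : ∀ {u w} → w ∈ matching u → Points w u
  ∈matching⁻ {u} = ∈-comprehension⁻ (matched? u)

  ∈matching⁺ : ∀ {u w} → Points w u → w ∈ matching u
  ∈matching⁺ {u} = ∈-comprehension⁺ (matched? u)

  matching-isMatching : IsMatching ⊤ matching
  matching-isMatching = record
    { within       = λ _ → ∈⊤
    ; man-unique   = λ h h′ → receiver-unique (∈matching⁻ h) (∈matching⁻ h′)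
    ; woman-unique = λ h h′ → proposer-unique (∈matching⁻ h) (∈matching⁻ h′)
    }

  open IsMatching matching-isMatching using (man-unique; woman-unique)

  module _ {M} (st : IsStable P ⊤ M) where
    open Join st₁ st
    private module J = IsMatching join-isMatching

    -- An arbitrary stable `M` may leave a man worse off than in `M₁`, but `M₁ ∨ M` does not, so it
    -- respects the permanent proposals.
    join-candidate : Candidate (λ w u → w ∈ join u)
    join-candidate = record
      { unique   = J.man-unique
      ; calm     = calm
      ; respects = respects
      }
      where
      calm : ∀ w u → w ∈ join u
           ⊎ (∃[ u′ ] w ∈ join u′ × rk w u′ < rk w u)
           ⊎ (∃[ w′ ] w′ ∈ join u × rr u w′ < rr u w)
      calm w u with join-calm u w
      ... | inj₁ h = inj₁ h
      ... | inj₂ (inj₁ (w′ , h , h′)) = inj₂ (inj₂ (w′ , h , manRank-mono P ⊤ u ∈⊤ ∈⊤ h′))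
      ... | inj₂ (inj₂ (u′ , h , h′)) = inj₂ (inj₁ (u′ , h , womanRank-mono P ⊤ ∈⊤ h′))

      respects : ∀ {w w′ u} → w′ ∈ M₁ u → w ∈ join u → ¬ rr u w′ < rr u w
      respects {u = u} w′∈ w∈ lt with manRank-reflects P ⊤ u ∈⊤ ∈⊤ lt | join-improves w′∈
      ... | w′≻w | w₀ , h₀ , w₀≽w′ with refl ← J.man-unique h₀ w∈ with w₀≽w′
      ...   | inj₁ refl = man-irrefl refl w′≻w
      ...   | inj₂ w≻w′ = man-asym w′≻w w≻w′

    join-best : ∀ {u w} → w ∈ join u →
                w ∈ matching u ⊎ (∃[ u′ ] w ∈ matching u′ × WomanPrefers w u′ u)
    join-best h with outcome-best join-candidate h
    ... | inj₁ p = inj₁ (∈matching⁺ p)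
    ... | inj₂ (u′ , p , lt) = inj₂ (u′ , ∈matching⁺ p , womanRank-reflects P ⊤ ∈⊤ lt)

    -- Send `u` to the man who holds his join-partner `w` in the outcome. By `join-best` that man is
    -- `u` or better for `w`, and stability of the join then shows that he is matched there too. The
    -- map is injective, hence onto, so every man matched in the join is matched in the outcome.
    join-matched : ∀ {u w} → w ∈ join u → ∃[ w′ ] w′ ∈ matching u
    join-matched {u} w∈ =
      let _ , w , _ , h = injective-relation⇒onto
            {S = λ u → ∃[ w ] w ∈ join u} {F = λ u u′ → ∃[ w ] w ∈ join u × w ∈ matching u′}
            (λ u → nonempty? (join u)) rematch
            (λ { (w , h , k) (w′ , h′ , k′) →
                 J.woman-unique h (subst (_∈ join _) (man-unique k′ k) h′) })
            u (_ , w∈)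
      in w , h
      where
      rematch : ∀ u → ∃[ w ] w ∈ join u →
                ∃[ u′ ] (∃[ w ] w ∈ join u′) × (∃[ w ] w ∈ join u × w ∈ matching u′)
      rematch u (w , h) with join-best h
      ... | inj₁ h′ = u , (w , h) , w , h , h′
      ... | inj₂ (u′ , h′ , u′≻u) with join-calm u′ w
      ...   | inj₁ h″ = u′ , (w , h″) , w , h , h′
      ...   | inj₂ (inj₁ (w″ , h″ , _)) = u′ , (w″ , h″) , w , h , h′
      ...   | inj₂ (inj₂ (u″ , h″ , u″≻u′)) with refl ← J.woman-unique h″ h =
        contradiction u′≻u (woman-asym u″≻u′)

  abstract
    someStable : ∃[ M ] IsStable P ⊤ M
    someStable = Stage₁.matching P ⊤ , IsMenOptimal.isStable (Stage₁.menOptimal P ⊤)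

    -- A man matched in `M₁` is matched in the join of `M₁` with any stable matching, hence in the
    -- outcome. A partner worse than `w` would be beaten by the permanent proposal of `w`.
    matching-improves : ∀ {u w} → w ∈ M₁ u → ∃[ w′ ] w′ ∈ matching u × w′ ≽⟨ u ⟩ w
    matching-improves {u} {w} h
      with M , st ← someStable
      with _ , h₁ , _ ← Join.join-improves st₁ st h
      with w′ , h′ ← join-matched st h₁
      with Man.compare u w′ w
    ... | tri< w′≻w _ _ = w′ , h′ , inj₂ w′≻w
    ... | tri≈ _ w′≡w _ = w′ , h′ , inj₁ w′≡w
    ... | tri> _ _ w≻w′ = contradiction (manRank-mono P ⊤ u ∈⊤ ∈⊤ w≻w′)
                            (unbeaten (∈matching⁻ h′) (inj₁ h))

  matching-calm : ∀ u w → Calm matching u w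
  matching-calm u w with outcome-calm w u
  ... | inj₁ p = inj₁ (∈matching⁺ p)
  ... | inj₂ (inj₁ (u′ , p , lt)) = inj₂ (inj₂ (u′ , ∈matching⁺ p , womanRank-reflects P ⊤ ∈⊤ lt))
  ... | inj₂ (inj₂ (w′ , inj₂ p , lt)) =
    inj₂ (inj₁ (w′ , ∈matching⁺ p , manRank-reflects P ⊤ u ∈⊤ ∈⊤ lt))
  -- The better offer is only a permanent one, but `u` really gets somebody at least as good.
  ... | inj₂ (inj₂ (w′ , inj₁ k , lt)) with matching-improves k | manRank-reflects P ⊤ u ∈⊤ ∈⊤ lt
  ...   | w″ , h , inj₁ refl  | w′≻w = inj₂ (inj₁ (w″ , h , w′≻w))
  ...   | w″ , h , inj₂ w″≻w′ | w′≻w = inj₂ (inj₁ (w″ , h , man-trans w″≻w′ w′≻w))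

  matching-stable : IsStable P ⊤ matching
  matching-stable = calm⇒stable matching-isMatching λ u w _ → matching-calm u w

  -- The common pair `(u , w)` lies in `M₁ ∨ M`. If the outcome gave `u` a better `w′`, stability of
  -- the join would give `w′` a man better than `u` there; by `join-best` she would have at least
  -- such a man in the outcome, where she has `u`.
  common-kept : ∀ {M} → IsStable P ⊤ M → ∀ {u w} → w ∈ M u → w ∈ M₁ u → w ∈ matching u
  common-kept {M} st {u} {w} h k with matching-improves k
  ... | w′ , h′ , inj₁ refl = h′
  ... | w′ , h′ , inj₂ w′≻w = contradiction (join-calm u w′) impossible
    where
    open Join st₁ st
    module J = IsMatching join-isMatching
    w∈join : w ∈ join u
    w∈join = join-common k h
    impossible : ¬ Calm join u w′
    impossible (inj₁ h″) = man-irrefl (J.man-unique h″ w∈join) w′≻w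
    impossible (inj₂ (inj₁ (w″ , h″ , w″≻w′))) with refl ← J.man-unique h″ w∈join =
      man-asym w″≻w′ w′≻w
    impossible (inj₂ (inj₂ (u′ , h″ , u′≻u))) with join-best st h″
    ... | inj₁ h₁ = woman-irrefl (woman-unique h₁ h′) u′≻u
    ... | inj₂ (u″ , h₁ , u″≻u′) with refl ← woman-unique h₁ h′ = woman-asym u″≻u′ u′≻u

  maxWeight : IsMaxWeightStable P ⊤ (indicator M₁) matching
  maxWeight = record
    { isStable = matching-stable
    ; maximal  = λ M st → weight-mono M₁ M matching (common-kept st)
    }

  matching-output : Outputs (run program₂ s₀) matching
  matching-output = subst (λ s → Outputs s matching) (sym final-run) (outputs {s = final} {matching}
    (λ x y → Sum.map₂ (λ (one , w , u , p , ex , ey) → one , u , w , ∈matching⁺ p , ex , ey)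
               (proj₁ final-correct x y))
    (λ {u} {w} h → proj₂ final-correct w u (∈matching⁻ h)))

-- Both stages with a common polynomial

module _ (k : ℕ)
  (cost₁≤k : cost program₁ * 2 ^ depth program₁ ≤ k) (depth₁≤k : depth program₁ ≤ k)
  (cost₂≤k : cost program₂ * 2 ^ depth program₂ ≤ k) (depth₂≤k : depth program₂ ≤ k) where

  implements : ∀ m n (P : Preferences m n) W₁ →
               Implements (compile program₁) (compile program₂) k P W₁
  implements m n P W₁ =
    S₁.matching , S₂.matching ,
    record { stage₁ = S₁.menOptimal ; stage₂ = S₂.maxWeight } ,
    computes S₁.matching program₁ _ (input-bounded P W₁ ∅) S₁.matching-output cost₁≤k depth₁≤k ,
    computes S₂.matching program₂ _ (input-bounded P ⊤ S₁.matching) S₂.matching-output cost₂≤k depth₂≤k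
    where
    module S₁ = Stage₁ P W₁
    module S₂ = Stage₂ P (IsMenOptimal.isStable S₁.menOptimal)

-- A single `k` has to dominate coefficient and exponent of both programs.
≤-sum-of-four : ∀ a b c d → ∃[ k ] a ≤ k × b ≤ k × c ≤ k × d ≤ k
≤-sum-of-four a b c d = a + b + (c + d)
  , ≤-trans (m≤m+n a b) (m≤m+n (a + b) (c + d)) , ≤-trans (m≤n+m b a) (m≤m+n (a + b) (c + d))
  , ≤-trans (m≤m+n c d) (m≤n+m (c + d) (a + b)) , ≤-trans (m≤n+m d c) (m≤n+m (c + d) (a + b))

theorem1 : (∃[ c₁ ] ∃[ c₂ ] ∃[ k ] (∀ (m n : ℕ) (P : Preferences m n) (W₁ : Subset n) → Implements c₁ c₂ k P W₁))
    × (∀ (m n : ℕ) (P : Preferences m n) (W₁ : Subset n) (M₁ M₂ : PairSet m n) → Opt2Stage P W₁ M₁ M₂ → IsOptimal P W₁ M₁ M₂)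
theorem1 =
  (let k , c₁≤k , d₁≤k , c₂≤k , d₂≤k =
         ≤-sum-of-four (cost program₁ * 2 ^ depth program₁) (depth program₁)
                       (cost program₂ * 2 ^ depth program₂) (depth program₂)
   in compile program₁ , compile program₂ , k , implements k c₁≤k d₁≤k c₂≤k d₂≤k)
  , λ m n P W₁ M₁ M₂ → opt2Stage⇒optimal P
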